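{- Let $X$ be a finite set with $|X|\ge 3$ and let $\mathcal S$ be a split system on $X$. Then $\mathcal S$ is injective if and only if $\mathcal S$ 4-dices, 5-dices and 6-dices $X$.
   Context: Let $X$ be a finite set with $|X|\ge 3$. A split of $X$ is an unordered bipartition $A|B=B|A$ of $X$ into two non-empty disjoint subsets (its parts) with $A\cup B=X$. Its size is $\min\{|A|,|B|\}$; a split of size $r$ is called an $r$-split, and a split of size 1 is called trivial. A split system on $X$ is a set $\mathcal S$ of splits of $X$ that contains all trivial splits $\{x\}|X-\{x\}$, $x\in X$. For $S\in\mathcal S$ and $x\in X$, $S(x)$ denotes the part of $S$ containing $x$. The Buneman graph $\mathcal B(\mathcal S)$ has as vertices all maps $\phi:\mathcal S\to\mathcal P(X)$ such that (B1) $\phi(S)\in S$ for all $S\in\mathcal S$, and (B2) $\phi(S)\cap\phi(S')\ne\emptyset$ for all distinct $S,S'\in\mathcal S$. Two vertices $\phi,\phi'$ are adjacent if there is a unique $S\in\mathcal S$ with $\phi(S)\neq\phi'(S)$. For $x\in X$, $\phi_x$ denotes the vertex $S\mapsto S(x)$. It is known that $\mathcal B(\mathcal S)$ is a median graph, i.e. it is connected and any three vertices $u,v,w$ have a unique median (a vertex lying on shortest paths between each pair of $u,v,w$). For $Y=\{x,y,z\}\in\binom X3$, $\phi_Y$ denotes the median of $\phi_x,\phi_y,\phi_z$ in $\mathcal B(\mathcal S)$. The split system $\mathcal S$ is injective if $\phi_Y\ne\phi_{Y'}$ for all distinct $Y,Y'\in\binom X3$. For $Y\subseteq X$ with $|Y|\ge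 3$, the restriction $\mathcal S|_Y$ is the split system on $Y$ consisting of all splits $S|_Y=(A\cap Y)|(B\cap Y)$ with $S=A|B\in\mathcal S$ (and both $A\cap Y$, $B\cap Y$ non-empty). $\mathcal S$ 4-dices $X$ if $|X|<4$ or, for all $Y\in\binom X4$, $\mathcal S|_Y$ contains at least two 2-splits. $\mathcal S$ 5-dices $X$ if $|X|<5$ or, for all $Y\in\binom X5$, $\mathcal S|_Y$ contains at least five 2-splits. $\mathcal S$ 6-dices $X$ if $|X|<6$ or, for all $Y\in\binom X6$, $\mathcal S|_Y$ contains at least one 3-split or a triangle of 2-splits, that is, three 2-splits of the form $\{x,y\}|Y-\{x,y\}$, $\{x,z\}|Y-\{x,z\}$, $\{y,z\}|Y-\{y,z\}$ with $x,y,z\in Y$ distinct. -}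

module Defs where

open import Data.Nat.Base using (ℕ; zero; suc; _≤_; _<_; _⊓_)
open import Data.Fin.Base using (Fin)
open import Data.Fin.Subset
  using (Subset; _∈_; _∩_; _∪_; _─_; ⁅_⁆; ⊤; ∣_∣; Nonempty; Empty)
open import Data.Fin.Subset.Properties using (_∈?_; ∈⊤; x∈p∩q⁺; x∈p∪q⁻)
open import Data.Product.Base using (Σ; ∃; ∃₂; _×_; _,_; proj₁; proj₂)
open import Data.Sum.Base using (_⊎_; inj₁; inj₂; [_,_]′)
open import Level using (0ℓ)
open import Relation.Binary.Core using (Rel)
open import Relation.Binary.Definitions using (_Respects_)
open import Relation.Binary.PropositionalEquality
  using (_≡_; _≢_; refl; sym; subst)
open import Relation.Nullary using (¬_; yes; no; contradiction)
open import Relation.Unary using (Pred; Decidable)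

private
  variable
    n : ℕ

------------------------------------------------------------------------
-- Graph medians

-- Vertices come with their own equality, so the empty walk joins
-- equal, not necessarily identical, vertices.
module Graph {V : Set} (_≈_ : Rel V 0ℓ) (_~_ : Rel V 0ℓ) where

  data Walk : V → V → Set where
    stop : ∀ {u v} → u ≈ v → Walk u v
    step : ∀ {u v w} → u ~ v → Walk v w → Walk u w

  length : ∀ {u v} → Walk u v → ℕ
  length (stop _)   = zero
  length (step _ p) = suc (length p)

  _LiesOn_ : ∀ {u v} → V → Walk u v → Set
  m LiesOn stop {u} _   = m ≈ u
  m LiesOn step {u} _ p = m ≈ u ⊎ m LiesOn p

  -- A walk of minimal length repeats no vertex, so these are exactly
  -- the shortest paths.
  IsShortest : ∀ {u v} → Walk u v → Set
  IsShortest {u} {v} p = (q : Walk u v) → length p ≤ length q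

  OnShortestPath : V → V → V → Set
  OnShortestPath m u v = Σ (Walk u v) λ p → IsShortest p × m LiesOn p

  IsMedian : V → V → V → V → Set
  IsMedian m u v w =
    OnShortestPath m u v × OnShortestPath m v w × OnShortestPath m u w

------------------------------------------------------------------------
-- Splits

-- A bipartition of Y listed in one of its two orders; the order is
-- forgotten by _≈_ below.
record Split (Y : Subset n) : Set where
  field
    left     : Subset n
    right    : Subset n
    nonemptyˡ : Nonempty left
    nonemptyʳ : Nonempty right
    disjoint : Empty (left ∩ right)
    covers   : left ∪ right ≡ Y

open Split public

module _ {Y : Subset n} where

  infix 4 _HasParts_,_ _≈_ _∈ᵖ_

  _HasParts_,_ : Split Y → Subset n → Subset n → Set
  S HasParts A , B =
    (left S ≡ A × right S ≡ B) ⊎ (left S ≡ B × right S ≡ A)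

  _≈_ : Rel (Split Y) 0ℓ
  S ≈ T = S HasParts left T , right T

  _∈ᵖ_ : Subset n → Split Y → Set
  A ∈ᵖ S = A ≡ left S ⊎ A ≡ right S

  size : Split Y → ℕ
  size S = ∣ left S ∣ ⊓ ∣ right S ∣

record SplitSystem (n : ℕ) : Set₁ where
  field
    Member  : Pred (Split (⊤ {n})) 0ℓ
    member? : Decidable Member
    resp    : Member Respects _≈_
    trivial : ∀ S → size S ≡ 1 → Member S

open SplitSystem public

------------------------------------------------------------------------
-- The part S(x) of S containing x

part : Split (⊤ {n}) → Fin n → Subset n
part S x with x ∈? left S
... | yes _ = left S
... | no  _ = right S

part-∈ᵖ : (S : Split (⊤ {n})) (x : Fin n) → part S x ∈ᵖ S
part-∈ᵖ S x with x ∈? left S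
... | yes _ = inj₁ refl
... | no  _ = inj₂ refl

∈-part : (S : Split (⊤ {n})) (x : Fin n) → x ∈ part S x
∈-part S x with x ∈? left S
... | yes x∈l = x∈l
... | no  x∉l =
  [ (λ x∈l → contradiction x∈l x∉l) , (λ x∈r → x∈r) ]′
    (x∈p∪q⁻ (left S) (right S) (subst (x ∈_) (sym (covers S)) ∈⊤))

part-unique : (S : Split (⊤ {n})) (x : Fin n) {A : Subset n} →
              A ∈ᵖ S → x ∈ A → A ≡ part S x
part-unique S x A∈S x∈A with x ∈? left S | A∈S
... | yes _   | inj₁ A≡l  = A≡l
... | yes x∈l | inj₂ refl = contradiction (x , x∈p∩q⁺ (x∈l , x∈A)) (disjoint S)
... | no  x∉l | inj₁ refl = contradiction x∈A x∉l
... | no  _   | inj₂ A≡r  = A≡r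

∈ᵖ-resp : {S T : Split (⊤ {n})} {A : Subset n} → S ≈ T → A ∈ᵖ S → A ∈ᵖ T
∈ᵖ-resp (inj₁ (refl , refl)) A∈S         = A∈S
∈ᵖ-resp (inj₂ (refl , refl)) (inj₁ A≡l) = inj₂ A≡l
∈ᵖ-resp (inj₂ (refl , refl)) (inj₂ A≡r) = inj₁ A≡r

part-cong : {S T : Split (⊤ {n})} (x : Fin n) → S ≈ T → part S x ≡ part T x
part-cong {S = S} {T} x S≈T =
  part-unique T x (∈ᵖ-resp {S = S} {T} S≈T (part-∈ᵖ S x)) (∈-part S x)

------------------------------------------------------------------------
-- The Buneman graph

module Buneman (𝒮 : SplitSystem n) where

  Element : Set
  Element = ∃ (Member 𝒮)

  infix 4 _≈ᴱ_ _≈ⱽ_ _~_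

  _≈ᴱ_ : Rel Element 0ℓ
  S ≈ᴱ T = proj₁ S ≈ proj₁ T

  record Vertex : Set where
    field
      φ    : Element → Subset n
      cong : ∀ S T → S ≈ᴱ T → φ S ≡ φ T
      B1   : ∀ S → φ S ∈ᵖ proj₁ S
      B2   : ∀ S T → ¬ (S ≈ᴱ T) → Nonempty (φ S ∩ φ T)

  open Vertex public

  _≈ⱽ_ : Rel Vertex 0ℓ
  u ≈ⱽ v = ∀ S → φ u S ≡ φ v S

  _~_ : Rel Vertex 0ℓ
  u ~ v = ∃ λ S → φ u S ≢ φ v S × (∀ T → φ u T ≢ φ v T → T ≈ᴱ S)

  open Graph _≈ⱽ_ _~_ public

  vertexOf : Fin n → Vertex
  vertexOf x = record
    { φ    = λ S → part (proj₁ S) x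
    ; cong = λ S T → part-cong {S = proj₁ S} {T = proj₁ T} x
    ; B1   = λ S → part-∈ᵖ (proj₁ S) x
    ; B2   = λ S T _ → x , x∈p∩q⁺ (∈-part (proj₁ S) x , ∈-part (proj₁ T) x)
    }

  -- m is φ_Y. Since 𝓑(𝒮) is a median graph, each Y with three elements
  -- has exactly one such m up to _≈ⱽ_; which names x, y, z the elements
  -- of Y receive is immaterial, as IsMedian is symmetric in them.
  IsMedianOf : Vertex → Subset n → Set
  IsMedianOf m Y = ∃ λ x → ∃₂ λ y z →
    Y ≡ ⁅ x ⁆ ∪ ⁅ y ⁆ ∪ ⁅ z ⁆ ×
    IsMedian m (vertexOf x) (vertexOf y) (vertexOf z)

Injective : SplitSystem n → Set
Injective {n} 𝒮 =
  (Y Y′ : Subset n) → ∣ Y ∣ ≡ 3 → ∣ Y′ ∣ ≡ 3 → Y ≢ Y′ →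
  (m m′ : Vertex) → IsMedianOf m Y → IsMedianOf m′ Y′ → ¬ (m ≈ⱽ m′)
  where open Buneman 𝒮

------------------------------------------------------------------------
-- Restriction and dicing

-- Both parts of T are non-empty by definition of Split, so splits of X
-- with a part missing Y contribute nothing.
_∣ʳ_ : SplitSystem n → (Y : Subset n) → Pred (Split Y) 0ℓ
(𝒮 ∣ʳ Y) T = ∃ λ S → Member 𝒮 S × T HasParts (left S ∩ Y) , (right S ∩ Y)

module _ {Y : Subset n} where

  AtLeast_[_]-splitsIn_ : ℕ → ℕ → Pred (Split Y) 0ℓ → Set
  AtLeast k [ r ]-splitsIn 𝒯 = Σ (Fin k → Split Y) λ T →
    (∀ i → 𝒯 (T i) × size (T i) ≡ r) × (∀ i j → T i ≈ T j → i ≡ j)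

  HasPairSplit : Pred (Split Y) 0ℓ → Fin n → Fin n → Set
  HasPairSplit 𝒯 x y = ∃ λ T →
    𝒯 T × size T ≡ 2 × T HasParts (⁅ x ⁆ ∪ ⁅ y ⁆) , (Y ─ (⁅ x ⁆ ∪ ⁅ y ⁆))

  HasTriangle : Pred (Split Y) 0ℓ → Set
  HasTriangle 𝒯 = ∃ λ x → ∃₂ λ y z →
    (x ∈ Y × y ∈ Y × z ∈ Y) × (x ≢ y × x ≢ z × y ≢ z) ×
    HasPairSplit 𝒯 x y × HasPairSplit 𝒯 x z × HasPairSplit 𝒯 y z

4-Dices : SplitSystem n → Set
4-Dices {n} 𝒮 = n < 4 ⊎
  ((Y : Subset n) → ∣ Y ∣ ≡ 4 → AtLeast 2 [ 2 ]-splitsIn (𝒮 ∣ʳ Y))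

5-Dices : SplitSystem n → Set
5-Dices {n} 𝒮 = n < 5 ⊎
  ((Y : Subset n) → ∣ Y ∣ ≡ 5 → AtLeast 5 [ 2 ]-splitsIn (𝒮 ∣ʳ Y))

6-Dices : SplitSystem n → Set
6-Dices {n} 𝒮 = n < 6 ⊎
  ((Y : Subset n) → ∣ Y ∣ ≡ 6 →
    AtLeast 1 [ 3 ]-splitsIn (𝒮 ∣ʳ Y) ⊎ HasTriangle (𝒮 ∣ʳ Y))

{-# OPTIONS --safe #-}

-- A vertex on a geodesic of the Buneman graph lies in every half-space
-- containing both ends, so the median of φ_x, φ_y, φ_z sends S to the part
-- containing at least two of x, y, z. Hence 𝒮 is injective iff for any two
-- distinct triples Y, Y′ some S ∈ 𝒮 has different majority parts on Y and Y′.
-- This depends only on the traces of 𝒮 on Y ∪ Y′, which has 4, 5 or 6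
-- elements, and there it is a finite statement about sets of bipartitions.
-- Dicing implies separation because too few bipartitions of the required size
-- fail to separate Y from Y′. Conversely, on 4 or 5 points a separating set of
-- bipartitions contains two, respectively five, 2-splits, and on 6 points one
-- without 3-splits contains a triangle; these are checked by a verified search.

module Submission where

open import Defs
open import Data.Bool.Base using (Bool; true; false; not; if_then_else_; T; _∧_; _∨_)
open import Data.Bool.ListAction using (any; all)
open import Data.Bool.Properties using (T-∧) renaming (_≟_ to _≟ᵇ_)
open import Data.Fin.Base using (Fin; zero; suc; inject≤)
open import Data.Fin.Properties
  using (suc-injective; all?; pigeonhole; inject≤-injective; <⇒≢)
  renaming (_≟_ to _≟ᶠ_; _<?_ to _<ᶠ?_; any? to anyᶠ?)
open import Data.Fin.Subset
open import Data.Fin.Subset.Properties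
open import Data.List.Base as List using (List; []; _∷_; _++_; filter; concatMap)
open import Data.List.Extrema.Nat using (argmax; argmax-sel; f[xs]≤f[argmax]; f[⊥]≤f[argmax])
open import Data.List.Membership.Propositional using (lose; find) renaming (_∈_ to _∈ˡ_)
open import Data.List.Membership.Propositional.Properties
  using (∈-map⁺; ∈-++⁺ˡ; ∈-++⁺ʳ; ∈-filter⁺; ∈-filter⁻; ∈-upTo⁺; ∈-lookup)
open import Data.List.Properties using (length-++; filter-all)
open import Data.List.Relation.Unary.All as All using (All; []; _∷_)
import Data.List.Relation.Unary.All.Properties as All
open import Data.List.Relation.Unary.AllPairs using (AllPairs; []; _∷_; allPairs?)
import Data.List.Relation.Unary.AllPairs.Properties as AllPairs
open import Data.List.Relation.Unary.Any as Any using (Any; here; there)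
open import Data.List.Relation.Unary.Any.Properties
  using (any⁻; lookup-index) renaming (concatMap⁺ to Any-concatMap⁺)
open import Data.Nat.Base
  using (ℕ; zero; suc; _+_; _≤_; _<_; _≤ᵇ_; _≡ᵇ_; _⊓_; s≤s; z≤n)
open import Data.Nat.Properties
  using ( ≤-refl; ≤-trans; ≤-reflexive; ≤-pred; ≰⇒>; <⇒≱; m≤n⇒m≤1+n; ≤ᵇ⇒≤; ≤⇒≤ᵇ; ≡ᵇ⇒≡
        ; +-suc; +-mono-≤; +-monoˡ-≤; +-cancelˡ-≤; +-cancelʳ-≡; m+n≤o⇒m≤o
        ; ⊓-comm; ⊓-glb; m≤n⊓o⇒m≤n; m≤n⊓o⇒m≤o; _≤?_; _<?_; module ≤-Reasoning)
  renaming (_≟_ to _≟ⁿ_)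
open import Data.List.Membership.DecPropositional _≟ⁿ_ using () renaming (_∈?_ to _∈ⁿ?_)
open import Data.Product.Base using (Σ; ∃; _×_; _,_; proj₁; proj₂)
open import Data.Sum.Base using (_⊎_; inj₁; inj₂; [_,_]′)
open import Data.Unit.Base using (tt)
open import Data.Vec.Base using ([]; _∷_; here; there; lookup; tabulate)
open import Data.Vec.Properties using (≡-dec; []=⇒lookup; lookup⇒[]=; lookup∘tabulate)
open import Function.Base using (_∘_; id)
open import Function.Bundles using (_⇔_; mk⇔; Equivalence)
open import Function.Definitions using () renaming (Injective to Injectiveᶠ)
open import Relation.Binary.PropositionalEquality
  using (_≡_; _≢_; refl; sym; trans; cong; cong₂; subst; module ≡-Reasoning)
open import Relation.Nullary using (¬_; Dec; yes; no; does; contradiction; ¬?)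
open import Relation.Nullary.Decidable
  using (_×-dec_; _⊎-dec_; _→-dec_; dec-true; decidable-stable; toWitness; T?)
open import Relation.Unary using (Decidable)

-- Injectivity quantifies over all medians, so the median description is needed in both directions:
-- every median of a triple is the majority vertex, and the majority vertex is a median. The latter
-- requires geodesics whose length is the number of splits that change.
--
-- The searches succeed for a graph-theoretic reason. On 5 or 6 points a 2-split is an edge, and it
-- separates two triples iff it lies inside exactly one of them. For triples meeting in two, one or
-- no points the separating edges form a 4-cycle, two triangles sharing a vertex, or two disjoint
-- triangles, so the missing edges contain none of these. On 5 points a graph without 4-cycles has
-- at most six edges, with six only for two triangles sharing a vertex; hence at most five of the
-- ten edges are missing. On 6 points suppose that there is no 3-split and no triangle. By Goodman's
-- bound two triangles are missing; they share exactly one vertex, the four edges across are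
-- present, and the sixth point then completes a triangle or a missing 4-cycle.

private
  variable
    k n : ℕ

-- Cardinalities and complements of finite subsets

∣p∪q∣+∣p∩q∣≡∣p∣+∣q∣ : (p q : Subset n) → ∣ p ∪ q ∣ + ∣ p ∩ q ∣ ≡ ∣ p ∣ + ∣ q ∣
∣p∪q∣+∣p∩q∣≡∣p∣+∣q∣ []            []            = refl
∣p∪q∣+∣p∩q∣≡∣p∣+∣q∣ (outside ∷ p) (outside ∷ q) = ∣p∪q∣+∣p∩q∣≡∣p∣+∣q∣ p q
∣p∪q∣+∣p∩q∣≡∣p∣+∣q∣ (outside ∷ p) (inside  ∷ q) =
  trans (cong suc (∣p∪q∣+∣p∩q∣≡∣p∣+∣q∣ p q)) (sym (+-suc ∣ p ∣ ∣ q ∣))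
∣p∪q∣+∣p∩q∣≡∣p∣+∣q∣ (inside  ∷ p) (outside ∷ q) =
  cong suc (∣p∪q∣+∣p∩q∣≡∣p∣+∣q∣ p q)
∣p∪q∣+∣p∩q∣≡∣p∣+∣q∣ (inside  ∷ p) (inside  ∷ q) = cong suc
  (trans (+-suc ∣ p ∪ q ∣ ∣ p ∩ q ∣)
    (trans (cong suc (∣p∪q∣+∣p∩q∣≡∣p∣+∣q∣ p q)) (sym (+-suc ∣ p ∣ ∣ q ∣))))

∣p∩q∣+∣∁p∩q∣≡∣q∣ : (p q : Subset n) → ∣ p ∩ q ∣ + ∣ ∁ p ∩ q ∣ ≡ ∣ q ∣
∣p∩q∣+∣∁p∩q∣≡∣q∣ []            []            = refl
∣p∩q∣+∣∁p∩q∣≡∣q∣ (outside ∷ p) (outside ∷ q) = ∣p∩q∣+∣∁p∩q∣≡∣q∣ p q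
∣p∩q∣+∣∁p∩q∣≡∣q∣ (inside  ∷ p) (outside ∷ q) = ∣p∩q∣+∣∁p∩q∣≡∣q∣ p q
∣p∩q∣+∣∁p∩q∣≡∣q∣ (outside ∷ p) (inside  ∷ q) =
  trans (+-suc ∣ p ∩ q ∣ ∣ ∁ p ∩ q ∣) (cong suc (∣p∩q∣+∣∁p∩q∣≡∣q∣ p q))
∣p∩q∣+∣∁p∩q∣≡∣q∣ (inside  ∷ p) (inside  ∷ q) = cong suc (∣p∩q∣+∣∁p∩q∣≡∣q∣ p q)

∁-involutive : (p : Subset n) → ∁ (∁ p) ≡ p
∁-involutive p = ⊆-antisym
  (λ x∈ → x∉∁p⇒x∈p (x∈∁p⇒x∉p x∈)) (λ x∈ → x∉p⇒x∈∁p (x∈p⇒x∉∁p x∈))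

x∈p⇒∣p∣≡1+∣p-x∣ : {p : Subset n} {x : Fin n} → x ∈ p → ∣ p ∣ ≡ suc ∣ p - x ∣
x∈p⇒∣p∣≡1+∣p-x∣ {p = _ ∷ p} here = cong (suc ∘ ∣_∣) (sym (p─⊥≡p p))
x∈p⇒∣p∣≡1+∣p-x∣ {p = outside ∷ p} (there x∈p) = x∈p⇒∣p∣≡1+∣p-x∣ x∈p
x∈p⇒∣p∣≡1+∣p-x∣ {p = inside  ∷ p} (there x∈p) = cong suc (x∈p⇒∣p∣≡1+∣p-x∣ x∈p)

x∉p-x : (p : Subset n) (x : Fin n) → x ∉ p - x
x∉p-x (_ ∷ p) zero    ()
x∉p-x (_ ∷ p) (suc x) (there x∈) = x∉p-x p x x∈

x∈p⇒0<∣p∣ : {p : Subset n} {x : Fin n} → x ∈ p → 0 < ∣ p ∣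
x∈p⇒0<∣p∣ x∈p rewrite x∈p⇒∣p∣≡1+∣p-x∣ x∈p = s≤s z≤n

0<∣p∣⇒Nonempty : (p : Subset n) → 0 < ∣ p ∣ → Nonempty p
0<∣p∣⇒Nonempty {n} p 0<∣p∣ with nonempty? p
... | yes ne = ne
... | no  em with refl ← Empty-unique em =
  contradiction (≤-trans 0<∣p∣ (≤-reflexive (∣⊥∣≡0 n))) (λ ())

x≢y⇒2≤∣p∣ : {p : Subset n} {x y : Fin n} → x ≢ y → x ∈ p → y ∈ p → 2 ≤ ∣ p ∣
x≢y⇒2≤∣p∣ {p = p} {x} {y} x≢y x∈p y∈p rewrite x∈p⇒∣p∣≡1+∣p-x∣ x∈p =
  s≤s (x∈p⇒0<∣p∣ (x∈p∧x≢y⇒x∈p-y y∈p (x≢y ∘ sym)))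

p⊆q∧∣q∣≤∣p∣⇒p≡q : {p q : Subset n} → p ⊆ q → ∣ q ∣ ≤ ∣ p ∣ → p ≡ q
p⊆q∧∣q∣≤∣p∣⇒p≡q {p = p} {q} p⊆q ∣q∣≤∣p∣ = ⊆-antisym p⊆q q⊆p
  where
  q⊆p : q ⊆ p
  q⊆p {x} x∈q with x ∈? p
  ... | yes x∈p = x∈p
  ... | no  x∉p = contradiction ∣q∣≤∣p∣ (<⇒≱ (p⊂q⇒∣p∣<∣q∣ (p⊆q , x , x∈q , x∉p)))

triple⊆ : {p : Subset n} {x y z : Fin n} → x ∈ p → y ∈ p → z ∈ p →
          ⁅ x ⁆ ∪ ⁅ y ⁆ ∪ ⁅ z ⁆ ⊆ p
triple⊆ {p = p} {x} {y} {z} x∈p y∈p z∈p v∈ with x∈p∪q⁻ ⁅ x ⁆ _ v∈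
... | inj₁ v∈x = subst (_∈ p) (sym (x∈⁅y⁆⇒x≡y x v∈x)) x∈p
... | inj₂ v∈yz with x∈p∪q⁻ ⁅ y ⁆ _ v∈yz
...   | inj₁ v∈y = subst (_∈ p) (sym (x∈⁅y⁆⇒x≡y y v∈y)) y∈p
...   | inj₂ v∈z = subst (_∈ p) (sym (x∈⁅y⁆⇒x≡y z v∈z)) z∈p

-- Transport of subsets along a function

preimage : (Fin k → Fin n) → Subset n → Subset k
preimage f A = tabulate (lookup A ∘ f)

module _ (f : Fin k → Fin n) where

  ∈-preimage⁺ : ∀ A {i} → f i ∈ A → i ∈ preimage f A
  ∈-preimage⁺ A {i} fi∈A =
    lookup⇒[]= i _ (trans (lookup∘tabulate (lookup A ∘ f) i) ([]=⇒lookup fi∈A))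

  ∈-preimage⁻ : ∀ A {i} → i ∈ preimage f A → f i ∈ A
  ∈-preimage⁻ A {i} i∈ =
    lookup⇒[]= (f i) A (trans (sym (lookup∘tabulate (lookup A ∘ f) i)) ([]=⇒lookup i∈))

  preimage-∁ : ∀ A → preimage f (∁ A) ≡ ∁ (preimage f A)
  preimage-∁ A = ⊆-antisym
    (λ i∈ → x∉p⇒x∈∁p (x∈∁p⇒x∉p (∈-preimage⁻ (∁ A) i∈) ∘ ∈-preimage⁻ A))
    (λ i∈ → ∈-preimage⁺ (∁ A) (x∉p⇒x∈∁p (x∈∁p⇒x∉p i∈ ∘ ∈-preimage⁺ A)))

  preimage-∩ : ∀ A B → preimage f (A ∩ B) ≡ preimage f A ∩ preimage f B
  preimage-∩ A B = ⊆-antisym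
    (λ i∈ → let a , b = x∈p∩q⁻ A B (∈-preimage⁻ (A ∩ B) i∈) in
      x∈p∩q⁺ (∈-preimage⁺ A a , ∈-preimage⁺ B b))
    (λ i∈ → let a , b = x∈p∩q⁻ (preimage f A) _ i∈ in
      ∈-preimage⁺ (A ∩ B) (x∈p∩q⁺ (∈-preimage⁻ A a , ∈-preimage⁻ B b)))

  preimage-∪ : ∀ A B → preimage f (A ∪ B) ≡ preimage f A ∪ preimage f B
  preimage-∪ A B = ⊆-antisym to from
    where
    to : preimage f (A ∪ B) ⊆ preimage f A ∪ preimage f B
    to i∈ with x∈p∪q⁻ A B (∈-preimage⁻ (A ∪ B) i∈)
    ... | inj₁ a = x∈p∪q⁺ (inj₁ (∈-preimage⁺ A a))
    ... | inj₂ b = x∈p∪q⁺ (inj₂ (∈-preimage⁺ B b))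
    from : preimage f A ∪ preimage f B ⊆ preimage f (A ∪ B)
    from i∈ with x∈p∪q⁻ (preimage f A) _ i∈
    ... | inj₁ a = ∈-preimage⁺ (A ∪ B) (x∈p∪q⁺ (inj₁ (∈-preimage⁻ A a)))
    ... | inj₂ b = ∈-preimage⁺ (A ∪ B) (x∈p∪q⁺ (inj₂ (∈-preimage⁻ B b)))

Covers : (Fin k → Fin n) → Subset n → Set
Covers f A = ∀ {x} → x ∈ A → ∃ λ i → f i ≡ x

-- Induction on the domain: if `f zero` lies in `A` it is deleted from `A`, which by injectivity
-- does not affect the preimage along `f ∘ suc`.
∣preimage∣ : (f : Fin k → Fin n) → Injectiveᶠ _≡_ _≡_ f →
             ∀ {A} → Covers f A → ∣ preimage f A ∣ ≡ ∣ A ∣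
∣preimage∣ {zero} {n} f inj {A} cov
  with refl ← Empty-unique {p = A} (λ (x , x∈A) → contradiction (proj₁ (cov x∈A)) λ ())
  = sym (∣⊥∣≡0 n)
∣preimage∣ {suc k} {n} f inj {A} cov with lookup A (f zero) in eq
... | outside = ∣preimage∣ (f ∘ suc) (suc-injective ∘ inj) cov′
  where
  cov′ : Covers (f ∘ suc) A
  cov′ x∈A with cov x∈A
  ... | zero  , refl = contradiction (trans (sym eq) ([]=⇒lookup x∈A)) λ ()
  ... | suc i , fi≡x = i , fi≡x
... | inside = begin
  suc ∣ preimage (f ∘ suc) A ∣            ≡⟨ cong (suc ∘ ∣_∣) same ⟩
  suc ∣ preimage (f ∘ suc) (A - f zero) ∣ ≡⟨ cong suc
    (∣preimage∣ (f ∘ suc) (suc-injective ∘ inj) cov′) ⟩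
  suc ∣ A - f zero ∣                      ≡⟨ x∈p⇒∣p∣≡1+∣p-x∣ (lookup⇒[]= (f zero) A eq) ⟨
  ∣ A ∣                                   ∎
  where
  open ≡-Reasoning
  cov′ : Covers (f ∘ suc) (A - f zero)
  cov′ x∈ with cov (p─q⊆p A ⁅ f zero ⁆ x∈)
  ... | zero  , refl = contradiction x∈ (x∉p-x A _)
  ... | suc i , fi≡x = i , fi≡x
  same : preimage (f ∘ suc) A ≡ preimage (f ∘ suc) (A - f zero)
  same = ⊆-antisym
    (λ {i} i∈ → ∈-preimage⁺ (f ∘ suc) (A - f zero)
      (x∈p∧x≢y⇒x∈p-y (∈-preimage⁻ (f ∘ suc) A i∈)
        (λ eq → contradiction (inj {suc i} {zero} eq) λ ())))
    (λ i∈ → ∈-preimage⁺ (f ∘ suc) A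
      (p─q⊆p A ⁅ f zero ⁆ (∈-preimage⁻ (f ∘ suc) (A - f zero) i∈)))

image : (Fin k → Fin n) → Subset k → Subset n
image f P = tabulate λ x → does (anyᶠ? λ i → (i ∈? P) ×-dec (f i ≟ᶠ x))

module _ (f : Fin k → Fin n) (P : Subset k) where

  ∈-image⁺ : ∀ {i} → i ∈ P → f i ∈ image f P
  ∈-image⁺ {i} i∈P = lookup⇒[]= (f i) _
    (trans (lookup∘tabulate _ (f i)) (dec-true (anyᶠ? _) (i , i∈P , refl)))

  ∈-image⁻ : ∀ {x} → x ∈ image f P → ∃ λ i → i ∈ P × f i ≡ x
  ∈-image⁻ {x} x∈ = ≡true⇒witness (anyᶠ? _)
    (trans (sym (lookup∘tabulate _ x)) ([]=⇒lookup x∈))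
    where
    ≡true⇒witness : ∀ {A : Set} (a? : Dec A) → does a? ≡ true → A
    ≡true⇒witness (yes a) _ = a

  preimage-image : Injectiveᶠ _≡_ _≡_ f → preimage f (image f P) ≡ P
  preimage-image inj = ⊆-antisym to (∈-preimage⁺ f (image f P) ∘ ∈-image⁺)
    where
    to : preimage f (image f P) ⊆ P
    to i∈ with ∈-image⁻ (∈-preimage⁻ f (image f P) i∈)
    ... | j , j∈P , fj≡fi = subst (_∈ P) (inj fj≡fi) j∈P

  image-Covers : Covers f (image f P)
  image-Covers x∈ with ∈-image⁻ x∈
  ... | i , _ , fi≡x = i , fi≡x

-- Numbering the elements of a subset

record Enumeration (Y : Subset n) (k : ℕ) : Set where
  field
    at        : Fin k → Fin n
    injective : Injectiveᶠ _≡_ _≡_ at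
    at∈       : ∀ i → at i ∈ Y
    onto      : Covers at Y

enumerate : (Y : Subset n) → Enumeration Y ∣ Y ∣
enumerate [] = record
  { at = λ () ; injective = λ { {()} } ; at∈ = λ () ; onto = λ () }
enumerate (outside ∷ Y) = record
  { at        = suc ∘ at
  ; injective = injective ∘ suc-injective
  ; at∈       = λ i → there (at∈ i)
  ; onto      = λ { (there x∈Y) → let i , eq = onto x∈Y in i , cong suc eq }
  }
  where open Enumeration (enumerate Y)
enumerate (inside ∷ Y) = record
  { at        = λ { zero → zero ; (suc i) → suc (at i) }
  ; injective = λ { {zero} {zero} _ → refl
                  ; {suc i} {suc j} eq → cong suc (injective (suc-injective eq)) }
  ; at∈       = λ { zero → here ; (suc i) → there (at∈ i) }
  ; onto      = λ { here → zero , refl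
                  ; (there x∈Y) → let i , eq = onto x∈Y in suc i , cong suc eq }
  }
  where open Enumeration (enumerate Y)

-- Filtered lists and the list of all subsets

module _ {A : Set} {P Q : A → Set} (P? : Decidable P) (Q? : Decidable Q)
         (P⊆Q : ∀ {x} → P x → Q x) where

  length-filter-≤ : ∀ xs → List.length (filter P? xs) ≤ List.length (filter Q? xs)
  length-filter-≤ [] = z≤n
  length-filter-≤ (x ∷ xs) with P? x | Q? x
  ... | yes p | yes q = s≤s (length-filter-≤ xs)
  ... | yes p | no ¬q = contradiction (P⊆Q p) ¬q
  ... | no ¬p | yes q = m≤n⇒m≤1+n (length-filter-≤ xs)
  ... | no ¬p | no ¬q = length-filter-≤ xs

  length-filter-< : ∀ {x xs} → x ∈ˡ xs → Q x → ¬ P x →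
                    List.length (filter P? xs) < List.length (filter Q? xs)
  length-filter-< {x} {_ ∷ xs} (here refl) Qx ¬Px with P? x | Q? x
  ... | yes p | _     = contradiction p ¬Px
  ... | no _  | yes _ = s≤s (length-filter-≤ xs)
  ... | no _  | no ¬q = contradiction Qx ¬q
  length-filter-< {x} {y ∷ xs} (there x∈) Qx ¬Px with P? y | Q? y
  ... | yes p | yes q = s≤s (length-filter-< x∈ Qx ¬Px)
  ... | yes p | no ¬q = contradiction (P⊆Q p) ¬q
  ... | no ¬p | yes q = m≤n⇒m≤1+n (length-filter-< x∈ Qx ¬Px)
  ... | no ¬p | no ¬q = length-filter-< x∈ Qx ¬Px

infix 4 _≟ˢ_

_≟ˢ_ : (p q : Subset n) → Dec (p ≡ q)
_≟ˢ_ = ≡-dec _≟ᵇ_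

subsets : ∀ n → List (Subset n)
subsets zero    = [] ∷ []
subsets (suc n) = List.map (inside ∷_) (subsets n) ++ List.map (outside ∷_) (subsets n)

∈-subsets : (p : Subset n) → p ∈ˡ subsets n
∈-subsets []            = here refl
∈-subsets (inside  ∷ p) = ∈-++⁺ˡ (∈-map⁺ (inside ∷_) (∈-subsets p))
∈-subsets (outside ∷ p) =
  ∈-++⁺ʳ (List.map (inside ∷_) (subsets _)) (∈-map⁺ (outside ∷_) (∈-subsets p))

-- Parts of splits

module _ {S : Split (⊤ {n})} where

  right≡∁left : right S ≡ ∁ (left S)
  right≡∁left = ⊆-antisym
    (λ x∈r → x∉p⇒x∈∁p (λ x∈l → disjoint S (_ , x∈p∩q⁺ (x∈l , x∈r))))
    (λ x∈∁l → [ (λ x∈l → contradiction x∈l (x∈∁p⇒x∉p x∈∁l)) , id ]′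
      (x∈p∪q⁻ (left S) (right S) (subst (_ ∈_) (sym (covers S)) ∈⊤)))

  ∁-∈ᵖ : ∀ {A} → A ∈ᵖ S → ∁ A ∈ᵖ S
  ∁-∈ᵖ (inj₁ refl) = inj₂ (sym right≡∁left)
  ∁-∈ᵖ (inj₂ refl) = inj₁ (trans (cong ∁ right≡∁left) (∁-involutive (left S)))

  ∈ᵖ-cases : ∀ {A B} → A ∈ᵖ S → B ∈ᵖ S → A ≡ B ⊎ A ≡ ∁ B
  ∈ᵖ-cases (inj₁ refl) (inj₁ refl) = inj₁ refl
  ∈ᵖ-cases (inj₂ refl) (inj₂ refl) = inj₁ refl
  ∈ᵖ-cases (inj₂ refl) (inj₁ refl) = inj₂ right≡∁left
  ∈ᵖ-cases (inj₁ refl) (inj₂ refl) =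
    inj₂ (sym (trans (cong ∁ right≡∁left) (∁-involutive (left S))))

  ∈ᵖ-nonempty : ∀ {A} → A ∈ᵖ S → Nonempty A
  ∈ᵖ-nonempty (inj₁ refl) = nonemptyˡ S
  ∈ᵖ-nonempty (inj₂ refl) = nonemptyʳ S

  left≢right : left S ≢ right S
  left≢right l≡r = disjoint S
    (proj₁ (nonemptyˡ S) , x∈p∩q⁺ (proj₂ (nonemptyˡ S) , subst (_ ∈_) l≡r (proj₂ (nonemptyˡ S))))

  two-valued : ∀ {A B C} → A ∈ᵖ S → B ∈ᵖ S → C ∈ᵖ S → A ≢ B → B ≢ C → A ≡ C
  two-valued A∈S B∈S C∈S A≢B B≢C with ∈ᵖ-cases A∈S B∈S | ∈ᵖ-cases C∈S B∈S
  ... | inj₁ A≡B  | _         = contradiction A≡B A≢B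
  ... | inj₂ _    | inj₁ C≡B  = contradiction (sym C≡B) B≢C
  ... | inj₂ A≡∁B | inj₂ C≡∁B = trans A≡∁B (sym C≡∁B)

module _ {Y : Subset n} where

  ≈-refl : (S : Split Y) → S ≈ S
  ≈-refl S = inj₁ (refl , refl)

  ≈-sym : (S T : Split Y) → S ≈ T → T ≈ S
  ≈-sym S T (inj₁ (l , r)) = inj₁ (sym l , sym r)
  ≈-sym S T (inj₂ (l , r)) = inj₂ (sym r , sym l)

  ≈-trans : (S T U : Split Y) → S ≈ T → T ≈ U → S ≈ U
  ≈-trans S T U (inj₁ (refl , refl)) T≈U = T≈U
  ≈-trans S T U (inj₂ (refl , refl)) (inj₁ (refl , refl)) = inj₂ (refl , refl)
  ≈-trans S T U (inj₂ (refl , refl)) (inj₂ (refl , refl)) = inj₁ (refl , refl)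

  -- Left abstract so that with can abstract over it.
  abstract
    _≈?_ : (S T : Split Y) → Dec (S ≈ T)
    S ≈? T = (left S ≟ˢ left T ×-dec right S ≟ˢ right T)
       ⊎-dec (left S ≟ˢ right T ×-dec right S ≟ˢ left T)

left∈ᵖ⇒≈ : (S T : Split (⊤ {n})) → left S ∈ᵖ T → S ≈ T
left∈ᵖ⇒≈ S T (inj₁ l≡l) =
  inj₁ (l≡l , trans (right≡∁left {S = S}) (trans (cong ∁ l≡l) (sym (right≡∁left {S = T}))))
left∈ᵖ⇒≈ S T (inj₂ l≡r) = inj₂ (l≡r , (begin
  right S        ≡⟨ right≡∁left {S = S} ⟩
  ∁ (left S)     ≡⟨ cong ∁ l≡r ⟩
  ∁ (right T)    ≡⟨ cong ∁ (right≡∁left {S = T}) ⟩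
  ∁ (∁ (left T)) ≡⟨ ∁-involutive (left T) ⟩
  left T         ∎))
  where open ≡-Reasoning

common-part⇒≈ : (S T : Split (⊤ {n})) {A : Subset n} → A ∈ᵖ S → A ∈ᵖ T → S ≈ T
common-part⇒≈ S T (inj₁ refl) A∈T = left∈ᵖ⇒≈ S T A∈T
common-part⇒≈ S T (inj₂ refl) A∈T = left∈ᵖ⇒≈ S T (subst (_∈ᵖ T)
  (trans (cong ∁ (right≡∁left {S = S})) (∁-involutive (left S))) (∁-∈ᵖ {S = T} A∈T))

bipartition : (A : Subset n) → Nonempty A → Nonempty (∁ A) → Split (⊤ {n})
bipartition A ne ne′ = record
  { left      = A
  ; right     = ∁ A
  ; nonemptyˡ = ne
  ; nonemptyʳ = ne′
  ; disjoint  = λ (x , x∈) → let x∈A , x∈∁A = x∈p∩q⁻ A (∁ A) x∈ in x∈∁p⇒x∉p x∈∁A x∈A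
  ; covers    = p∪∁p≡⊤ A
  }

-- Geodesics of the Buneman graph

module Geodesics (𝒮 : SplitSystem n) where

  open Buneman 𝒮 renaming (cong to φ-cong)

  ≈ⱽ-sym : ∀ {u v} → u ≈ⱽ v → v ≈ⱽ u
  ≈ⱽ-sym u≈v S = sym (u≈v S)

  walk-respˡ : ∀ {u v w} → u ≈ⱽ v → (p : Walk v w) → Σ (Walk u w) λ q → length q ≡ length p
  walk-respˡ u≈v (stop v≈w) = stop (λ S → trans (u≈v S) (v≈w S)) , refl
  walk-respˡ u≈v (step (S , v≢w , unique) p) = step (S
    , (λ u≡w → v≢w (trans (sym (u≈v S)) u≡w))
    , (λ T u≢w → unique T (λ v≡w → u≢w (trans (u≈v T) v≡w)))) p , refl

  walk-respʳ : ∀ {u v w} → v ≈ⱽ w → (p : Walk u v) → Σ (Walk u w) λ q → length q ≡ length p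
  walk-respʳ v≈w (stop u≈v)   = stop (λ S → trans (u≈v S) (v≈w S)) , refl
  walk-respʳ v≈w (step u~ p) =
    let q , eq = walk-respʳ v≈w p in step u~ q , cong suc eq

  start-LiesOn : ∀ {m u v} → m ≈ⱽ u → (p : Walk u v) → m LiesOn p
  start-LiesOn m≈u (stop _)   = m≈u
  start-LiesOn m≈u (step _ _) = inj₁ m≈u

  -- The gate map retracts 𝓑(𝒮) onto the half-space of vertices choosing
  -- the part A of S. It sends a walk to a walk that is strictly shorter if
  -- the original left the half-space, so geodesics stay inside.
  module Gate (S : Element) {A : Subset n} (A∈S : A ∈ᵖ proj₁ S) where

    toward : Subset n → Subset n
    toward B = if does (nonempty? (B ∩ A)) then B else ∁ B

    -- A part missing `A` is exchanged for one containing `A`. So two exchanged parts meet in `A`,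
    -- an exchanged part meets a kept one in `A`, and two kept parts meet by (B2) for the original
    -- vertex.
    toward-spec : ∀ B → (Nonempty (B ∩ A) × toward B ≡ B) ⊎ (A ⊆ ∁ B × toward B ≡ ∁ B)
    toward-spec B with nonempty? (B ∩ A)
    ... | yes ne = inj₁ (ne , refl)
    ... | no  em = inj₂ ((λ x∈A → x∉p⇒x∈∁p (λ x∈B → em (_ , x∈p∩q⁺ (x∈B , x∈A)))) , refl)

    gate : Vertex → Vertex
    gate w = record
      { φ    = toward ∘ φ w
      ; cong = λ T U T≈U → cong toward (φ-cong w T U T≈U)
      ; B1   = b1
      ; B2   = b2
      }
      where
      b1 : ∀ T → toward (φ w T) ∈ᵖ proj₁ T
      b1 T with toward-spec (φ w T)
      ... | inj₁ (_ , eq) = subst (_∈ᵖ proj₁ T) (sym eq) (B1 w T)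
      ... | inj₂ (_ , eq) = subst (_∈ᵖ proj₁ T) (sym eq) (∁-∈ᵖ {S = proj₁ T} (B1 w T))
      b2 : ∀ T U → ¬ (T ≈ᴱ U) → Nonempty (toward (φ w T) ∩ toward (φ w U))
      b2 T U T≉U with toward-spec (φ w T) | toward-spec (φ w U)
      ... | inj₁ (_ , eq) | inj₁ (_ , eq′) rewrite eq | eq′ = B2 w T U T≉U
      ... | inj₁ ((x , x∈) , eq) | inj₂ (A⊆ , eq′) rewrite eq | eq′ =
        let x∈φ , x∈A = x∈p∩q⁻ (φ w T) A x∈ in x , x∈p∩q⁺ (x∈φ , A⊆ x∈A)
      ... | inj₂ (A⊆ , eq) | inj₁ ((x , x∈) , eq′) rewrite eq | eq′ =
        let x∈φ , x∈A = x∈p∩q⁻ (φ w U) A x∈ in x , x∈p∩q⁺ (A⊆ x∈A , x∈φ)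
      ... | inj₂ (A⊆ , eq) | inj₂ (A⊆′ , eq′) rewrite eq | eq′ =
        let x , x∈A = ∈ᵖ-nonempty {S = proj₁ S} A∈S in x , x∈p∩q⁺ (A⊆ x∈A , A⊆′ x∈A)

    gate-at : ∀ w T → T ≈ᴱ S → φ (gate w) T ≡ A
    gate-at w T T≈S with toward-spec (φ w T)
       | ∈ᵖ-cases {S = proj₁ S} (∈ᵖ-resp {S = proj₁ T} {proj₁ S} T≈S (B1 w T)) A∈S
    ... | inj₁ (_ , eq) | inj₁ φ≡A = trans eq φ≡A
    ... | inj₂ (_ , eq) | inj₂ φ≡∁A = trans eq (trans (cong ∁ φ≡∁A) (∁-involutive A))
    ... | inj₁ ((x , x∈) , _) | inj₂ φ≡∁A =
      let x∈φ , x∈A = x∈p∩q⁻ (φ w T) A x∈ in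
      contradiction x∈A (x∈∁p⇒x∉p (subst (x ∈_) φ≡∁A x∈φ))
    ... | inj₂ (A⊆ , _) | inj₁ φ≡A =
      let x , x∈A = ∈ᵖ-nonempty {S = proj₁ S} A∈S in
      contradiction x∈A (x∈∁p⇒x∉p (subst (λ B → x ∈ ∁ B) φ≡A (A⊆ x∈A)))

    -- By (B2) for `T` and `S`, the part that `u` chooses at any other split `T` already meets `A`,
    -- so nothing is exchanged.
    gate-fixed : ∀ u → φ u S ≡ A → gate u ≈ⱽ u
    gate-fixed u u∋A T with proj₁ T ≈? proj₁ S
    ... | yes T≈S = trans (gate-at u T T≈S) (trans (sym u∋A) (sym (φ-cong u T S T≈S)))
    ... | no  T≉S with toward-spec (φ u T) | B2 u T S T≉S
    ...   | inj₁ (_ , eq) | _ = eq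
    ...   | inj₂ (A⊆ , _) | x , x∈ =
      let x∈φ , x∈φS = x∈p∩q⁻ (φ u T) _ x∈ in
      contradiction x∈φ (x∈∁p⇒x∉p (A⊆ (subst (x ∈_) u∋A x∈φS)))

    -- A step is lost when its ends have the same gate. A walk that ends inside the half-space but
    -- visits a vertex outside it must cross `S`, and that step is lost because both gates choose
    -- `A` at `S`.
    gate-walk : ∀ {u v} (p : Walk u v) → φ v S ≡ A →
                Σ (Walk (gate u) (gate v)) λ q → length q ≤ length p ×
                  (∀ m → m LiesOn p → φ m S ≢ A → length q < length p)
    gate-walk (stop u≈v) v∋A =
      stop (cong toward ∘ u≈v) , z≤n ,
      λ m m≈u m∌A → contradiction (trans (m≈u S) (trans (u≈v S) v∋A)) m∌A
    gate-walk {u} (step {v = w} (R , u≢w , unique) p) v∋A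
      with gate-walk p v∋A | φ (gate u) R ≟ˢ φ (gate w) R
    ... | q , q≤p , _ | yes eq =
      let r , r≡q = walk-respˡ gate-u≈gate-w q
          r≤p = ≤-trans (≤-reflexive r≡q) q≤p
      in r , m≤n⇒m≤1+n r≤p , λ _ _ _ → s≤s r≤p
      where
      -- `u` and `w` differ at `R` alone, so agreement of their gates at `R` is agreement
      -- everywhere.
      gate-u≈gate-w : gate u ≈ⱽ gate w
      gate-u≈gate-w T with φ u T ≟ˢ φ w T
      ... | yes u≡w = cong toward u≡w
      ... | no  u≢w =
        trans (φ-cong (gate u) T R (unique T u≢w))
          (trans eq (sym (φ-cong (gate w) T R (unique T u≢w))))
    ... | q , q≤p , q<p | no neq =
      step (R , neq , λ T d → unique T (d ∘ cong toward)) q , s≤s q≤p , strict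
      where
      strict : ∀ m → m ≈ⱽ u ⊎ m LiesOn p → φ m S ≢ A → suc (length q) < suc (length p)
      strict m (inj₂ m∈p) m∌A = s≤s (q<p m m∈p m∌A)
      -- The visited vertex is the start `u`. If `w` is outside too, a later step is lost; otherwise
      -- this very step crosses `S`, so it cannot have survived.
      strict m (inj₁ m≈u) m∌A with φ w S ≟ˢ A
      ... | no  w∌A = s≤s (q<p w (start-LiesOn (λ _ → refl) p) w∌A)
      ... | yes w∋A = contradiction
        (trans (gate-at u R R≈S) (sym (gate-at w R R≈S))) neq
        where
        R≈S : R ≈ᴱ S
        R≈S = ≈-sym (proj₁ S) (proj₁ R)
          (unique S (λ u≡w → m∌A (trans (m≈u S) (trans u≡w w∋A))))

  on-geodesic⇒between : ∀ {m u v} → OnShortestPath m u v →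
                        ∀ S → φ u S ≡ φ v S → φ m S ≡ φ u S
  on-geodesic⇒between {m} {u} {v} (p , shortest , m∈p) S u≡v
    with φ m S ≟ˢ φ u S
  ... | yes m≡u = m≡u
  ... | no  m≢u =
    let q , _ , q<p = gate-walk p (sym u≡v)
        r , r≡q = walk-respˡ (≈ⱽ-sym {gate u} {u} (gate-fixed u refl)) q
        s , s≡r = walk-respʳ (gate-fixed v (sym u≡v)) r
    in contradiction (shortest s)
         (<⇒≱ (≤-trans (s≤s (≤-reflexive (trans s≡r r≡q))) (q<p m m∈p m≢u)))
    where open Gate S (B1 u S)

  -- Finiteness of the split system up to equality of splits

  element-of : Subset n → List Element
  element-of A with nonempty? A | nonempty? (∁ A)
  ... | no _   | _      = []
  ... | yes _  | no _   = []
  ... | yes ne | yes ne′ with member? 𝒮 (bipartition A ne ne′)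
  ...   | yes S∈𝒮 = (_ , S∈𝒮) ∷ []
  ...   | no  _   = []

  -- Every subset is tried as a left part, so each split is listed once in each of its two orders.
  -- The list makes quantification over `Element` decidable and bounds the number of flips needed
  -- below.
  elements : List Element
  elements = concatMap element-of (subsets n)

  element-of-left : (T : Element) → Any (T ≈ᴱ_) (element-of (left (proj₁ T)))
  element-of-left (T , T∈𝒮) with nonempty? (left T) | nonempty? (∁ (left T))
  ... | no em  | _     = contradiction (nonemptyˡ T) em
  ... | yes _  | no em =
    contradiction (subst Nonempty (right≡∁left {S = T}) (nonemptyʳ T)) em
  ... | yes ne | yes ne′ with member? 𝒮 (bipartition (left T) ne ne′)
  ...   | yes _  = here (inj₁ (refl , right≡∁left {S = T}))
  ...   | no S∉𝒮 = contradiction (resp 𝒮 (inj₁ (refl , right≡∁left {S = T})) T∈𝒮) S∉𝒮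

  elements-complete : (T : Element) → Any (T ≈ᴱ_) elements
  elements-complete T = Any-concatMap⁺ element-of
    (Any.map (λ { refl → element-of-left T }) (∈-subsets (left (proj₁ T))))

  ∀elements⇒∀ : (P : Element → Set) → (∀ S T → S ≈ᴱ T → P T → P S) →
                All P elements → ∀ T → P T
  ∀elements⇒∀ P P-resp all T with All.lookupAny all (elements-complete T)
  ... | p , T≈S = P-resp T _ T≈S p

  -- Flipping u to v at a split R where they differ preserves (B2) if the
  -- part of R chosen by v has maximal size among all such splits.
  module Flip (u v : Vertex) (R : Element)
              (maximal : ∀ T → φ u T ≢ φ v T → ∣ φ v T ∣ ≤ ∣ φ v R ∣) where

    flipφ : Element → Subset n
    flipφ T = if does (proj₁ T ≈? proj₁ R) then φ v T else φ u T

    flipφ-spec : ∀ T → (T ≈ᴱ R × flipφ T ≡ φ v T) ⊎ (¬ (T ≈ᴱ R) × flipφ T ≡ φ u T)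
    flipφ-spec T with proj₁ T ≈? proj₁ R
    ... | yes T≈R = inj₁ (T≈R , refl)
    ... | no  T≉R = inj₂ (T≉R , refl)

    -- If `u` and `v` agree at `U`, this is (B2) for `v`. If they differ there and the parts were
    -- disjoint, `φ v T` would be contained in `φ v U`; maximality makes them equal, and splits
    -- sharing a part coincide.
    parts-meet : ∀ T U → ¬ (T ≈ᴱ U) → T ≈ᴱ R → Nonempty (φ v T ∩ φ u U)
    parts-meet T U T≉U T≈R with φ u U ≟ˢ φ v U | nonempty? (φ v T ∩ φ u U)
    ... | yes u≡v | _      = subst (λ B → Nonempty (φ v T ∩ B)) (sym u≡v) (B2 v T U T≉U)
    ... | no  _   | yes ne = ne
    ... | no  u≢v | no  em = contradiction
      (common-part⇒≈ (proj₁ T) (proj₁ U) (B1 v T) (subst (_∈ᵖ proj₁ U) (sym vT≡vU) (B1 v U))) T≉U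
      where
      vU≡∁uU : φ v U ≡ ∁ (φ u U)
      vU≡∁uU = [ (λ eq → contradiction (sym eq) u≢v) , id ]′
        (∈ᵖ-cases {S = proj₁ U} (B1 v U) (B1 u U))
      vT⊆vU : φ v T ⊆ φ v U
      vT⊆vU x∈vT = subst (_ ∈_) (sym vU≡∁uU)
        (x∉p⇒x∈∁p (λ x∈uU → em (_ , x∈p∩q⁺ (x∈vT , x∈uU))))
      vT≡vU : φ v T ≡ φ v U
      vT≡vU = p⊆q∧∣q∣≤∣p∣⇒p≡q vT⊆vU
        (≤-trans (maximal U u≢v) (≤-reflexive (cong ∣_∣ (sym (φ-cong v T R T≈R)))))

    flip : Vertex
    flip = record
      { φ    = flipφ
      ; cong = c
      ; B1   = b1
      ; B2   = b2
      }
      where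
      c : ∀ T U → T ≈ᴱ U → flipφ T ≡ flipφ U
      c T U T≈U with flipφ-spec T | flipφ-spec U
      ... | inj₁ (_ , eq) | inj₁ (_ , eq′) = trans eq (trans (φ-cong v T U T≈U) (sym eq′))
      ... | inj₂ (_ , eq) | inj₂ (_ , eq′) = trans eq (trans (φ-cong u T U T≈U) (sym eq′))
      ... | inj₁ (T≈R , _) | inj₂ (U≉R , _) = contradiction
        (≈-trans (proj₁ U) (proj₁ T) (proj₁ R) (≈-sym (proj₁ T) (proj₁ U) T≈U) T≈R) U≉R
      ... | inj₂ (T≉R , _) | inj₁ (U≈R , _) = contradiction
        (≈-trans (proj₁ T) (proj₁ U) (proj₁ R) T≈U U≈R) T≉R
      b1 : ∀ T → flipφ T ∈ᵖ proj₁ T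
      b1 T with flipφ-spec T
      ... | inj₁ (_ , eq) = subst (_∈ᵖ proj₁ T) (sym eq) (B1 v T)
      ... | inj₂ (_ , eq) = subst (_∈ᵖ proj₁ T) (sym eq) (B1 u T)
      b2 : ∀ T U → ¬ (T ≈ᴱ U) → Nonempty (flipφ T ∩ flipφ U)
      b2 T U T≉U with flipφ-spec T | flipφ-spec U
      ... | inj₂ (_ , eq) | inj₂ (_ , eq′) rewrite eq | eq′ = B2 u T U T≉U
      ... | inj₁ (T≈R , eq) | inj₂ (_ , eq′) rewrite eq | eq′ = parts-meet T U T≉U T≈R
      ... | inj₂ (_ , eq) | inj₁ (U≈R , eq′) rewrite eq | eq′ =
        subst Nonempty (∩-comm (φ v U) (φ u T))
          (parts-meet U T (T≉U ∘ ≈-sym (proj₁ U) (proj₁ T)) U≈R)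
      ... | inj₁ (T≈R , _) | inj₁ (U≈R , _) = contradiction
        (≈-trans (proj₁ T) (proj₁ R) (proj₁ U) T≈R (≈-sym (proj₁ U) (proj₁ R) U≈R)) T≉U

  -- Walks that change each differing split exactly once

  Distinct : List Element → Set
  Distinct = AllPairs (λ S T → ¬ (S ≈ᴱ T))

  Differ : Vertex → Vertex → Element → Set
  Differ u v T = φ u T ≢ φ v T

  differ? : ∀ u v → Decidable (Differ u v)
  differ? u v T = ¬? (φ u T ≟ˢ φ v T)

  -- The list `Rs` certifies minimality: `distinct-differences≤length` bounds every walk between the
  -- same ends from below by its length.
  DirectWalk : Vertex → Vertex → Set
  DirectWalk u v = Σ (Walk u v) λ p → ∃ λ Rs →
    length p ≡ List.length Rs × Distinct Rs × All (Differ u v) Rs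

  -- A step changes a single split, so after it all listed differences but at most one persist; the
  -- list being distinct, removing that split shortens it by at most one.
  distinct-differences≤length : ∀ {u v} (q : Walk u v) {Rs} → Distinct Rs →
                                All (Differ u v) Rs → List.length Rs ≤ length q
  distinct-differences≤length (stop _) {[]} _ _ = z≤n
  distinct-differences≤length (stop u≈v) {R ∷ _} _ (d ∷ _) = contradiction (u≈v R) d
  distinct-differences≤length {u} {v} (step {v = w} (S , _ , unique) q) {Rs} dist diff = begin
    List.length Rs                        ≤⟨ removes-one Rs dist ⟩
    suc (List.length (filter ≉S? Rs))     ≤⟨ s≤s (distinct-differences≤length q
      (AllPairs.filter⁺ ≉S? dist)
      (All.zipWith differ-wv (All.filter⁺ ≉S? diff , All.all-filter ≉S? Rs))) ⟩
    suc (length q)                        ∎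
    where
    open ≤-Reasoning
    ≉S? : Decidable (λ T → ¬ (T ≈ᴱ S))
    ≉S? T = ¬? (proj₁ T ≈? proj₁ S)
    differ-wv : ∀ {T} → Differ u v T × ¬ (T ≈ᴱ S) → Differ w v T
    differ-wv {T} (u≢v , T≉S) w≡v = u≢v (trans
      (decidable-stable (φ u T ≟ˢ φ w T) (λ u≢w → T≉S (unique T u≢w))) w≡v)
    removes-one : ∀ Rs → Distinct Rs → List.length Rs ≤ suc (List.length (filter ≉S? Rs))
    removes-one [] _ = z≤n
    removes-one (T ∷ Rs) (T≉ ∷ dist) with proj₁ T ≈? proj₁ S
    ... | no  T≉S = s≤s (removes-one Rs dist)
    ... | yes T≈S = s≤s (≤-reflexive (sym (cong List.length (filter-all ≉S?
      (All.map (λ {U} T≉U U≈S → T≉U (≈-trans (proj₁ T) (proj₁ S) (proj₁ U) T≈S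
        (≈-sym (proj₁ U) (proj₁ S) U≈S))) T≉)))))

  -- Induction on a bound for the number of listed elements where `u` and `v` differ. Flipping the
  -- one whose `v`-part is largest is legitimate by `Flip`, settles that split for good and creates
  -- no new difference.
  directWalk : ∀ k u v → List.length (filter (differ? u v) elements) ≤ k → DirectWalk u v
  directWalk k u v bound with filter (differ? u v) elements in eq
  directWalk k u v bound | [] = stop (∀elements⇒∀ (λ T → φ u T ≡ φ v T)
      (λ S T S≈T u≡v → trans (φ-cong u S T S≈T) (trans u≡v (sym (φ-cong v S T S≈T))))
      (All.tabulate λ {T} T∈ → decidable-stable (φ u T ≟ˢ φ v T) λ u≢v →
        contradiction (subst (T ∈ˡ_) eq (∈-filter⁺ (differ? u v) T∈ u≢v)) λ ()))
    , [] , refl , [] , []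
  directWalk (suc k) u v (s≤s bound) | D ∷ Ds =
    let p , Rs , len , dist , diff = directWalk k flip v (≤-pred (≤-trans fewer
          (≤-trans (≤-reflexive (cong List.length eq)) (s≤s bound))))
    in step (R , (λ u≡f → uR≢vR (trans u≡f (flip-at R (≈-refl (proj₁ R))))) , unique) p
     , R ∷ Rs , cong suc len
     , All.map (λ {T} f≢v R≈T → f≢v (flip-at T (≈-sym (proj₁ R) (proj₁ T) R≈T))) diff ∷ dist
     , uR≢vR ∷ All.map (λ {T} → flip-differ T) diff
    where
    size-v : Element → ℕ
    size-v T = ∣ φ v T ∣
    R : Element
    R = argmax size-v D Ds
    R∈ : R ∈ˡ filter (differ? u v) elements
    R∈ = subst (R ∈ˡ_) (sym eq) ([ here , there ]′ (argmax-sel size-v D Ds))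
    uR≢vR : Differ u v R
    uR≢vR = proj₂ (∈-filter⁻ (differ? u v) {xs = elements} R∈)
    maximal : ∀ T → Differ u v T → ∣ φ v T ∣ ≤ ∣ φ v R ∣
    maximal = ∀elements⇒∀ _
      (λ S T S≈T max u≢v → ≤-trans (≤-reflexive (cong ∣_∣ (φ-cong v S T S≈T)))
        (max λ u≡v → u≢v (trans (φ-cong u S T S≈T)
          (trans u≡v (sym (φ-cong v S T S≈T))))))
      (All.tabulate λ {T} T∈ u≢v → All.lookup max-Ds
        (subst (T ∈ˡ_) eq (∈-filter⁺ (differ? u v) T∈ u≢v)))
      where
      max-Ds : All (λ T → ∣ φ v T ∣ ≤ ∣ φ v R ∣) (D ∷ Ds)
      max-Ds = f[⊥]≤f[argmax] {f = size-v} D Ds ∷ f[xs]≤f[argmax] {f = size-v} D Ds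
    open Flip u v R maximal
    flip-at : ∀ T → T ≈ᴱ R → φ flip T ≡ φ v T
    flip-at T T≈R with flipφ-spec T
    ... | inj₁ (_ , eq)  = eq
    ... | inj₂ (T≉R , _) = contradiction T≈R T≉R
    flip-differ : ∀ T → Differ flip v T → Differ u v T
    flip-differ T f≢v u≡v with flipφ-spec T
    ... | inj₁ (_ , eq) = f≢v eq
    ... | inj₂ (_ , eq) = f≢v (trans eq u≡v)
    unique : ∀ T → φ u T ≢ φ flip T → T ≈ᴱ R
    unique T u≢f with flipφ-spec T
    ... | inj₁ (T≈R , _) = T≈R
    ... | inj₂ (_ , eq)  = contradiction (sym eq) u≢f
    fewer : List.length (filter (differ? flip v) elements)
          < List.length (filter (differ? u v) elements)
    fewer = length-filter-< (differ? flip v) (differ? u v) (λ {T} → flip-differ T)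
      (proj₁ (∈-filter⁻ (differ? u v) {xs = elements} R∈)) uR≢vR
      (λ f≢v → f≢v (flip-at R (≈-refl (proj₁ R))))


-- Majority parts with respect to a triple

maj : Subset n → Subset n → Bool
maj A Y = 2 ≤ᵇ ∣ A ∩ Y ∣

module Majority (Y : Subset n) (∣Y∣≡3 : ∣ Y ∣ ≡ 3) where

  -- Two plus two exceeds three. This yields (B2) for the majority vertex and the uniqueness of the
  -- majority part.
  big-meet : ∀ {A B} → 2 ≤ ∣ A ∩ Y ∣ → 2 ≤ ∣ B ∩ Y ∣ → Nonempty (A ∩ B)
  big-meet {A} {B} A-big B-big =
    let x , x∈ = 0<∣p∣⇒Nonempty ((A ∩ Y) ∩ (B ∩ Y)) (+-cancelˡ-≤ 3 1 _ 4≤)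
        x∈A∩Y , x∈B∩Y = x∈p∩q⁻ (A ∩ Y) (B ∩ Y) x∈
    in x , x∈p∩q⁺ (p∩q⊆p A Y x∈A∩Y , p∩q⊆p B Y x∈B∩Y)
    where
    open ≤-Reasoning
    ∪⊆Y : (A ∩ Y) ∪ (B ∩ Y) ⊆ Y
    ∪⊆Y x∈ = [ p∩q⊆q A Y , p∩q⊆q B Y ]′ (x∈p∪q⁻ (A ∩ Y) (B ∩ Y) x∈)
    4≤ : 4 ≤ 3 + ∣ (A ∩ Y) ∩ (B ∩ Y) ∣
    4≤ = begin
      4
        ≤⟨ +-mono-≤ A-big B-big ⟩
      ∣ A ∩ Y ∣ + ∣ B ∩ Y ∣
        ≡⟨ ∣p∪q∣+∣p∩q∣≡∣p∣+∣q∣ (A ∩ Y) (B ∩ Y) ⟨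
      ∣ (A ∩ Y) ∪ (B ∩ Y) ∣ + ∣ (A ∩ Y) ∩ (B ∩ Y) ∣
        ≤⟨ +-monoˡ-≤ _ (p⊆q⇒∣p∣≤∣q∣ ∪⊆Y) ⟩
      ∣ Y ∣ + ∣ (A ∩ Y) ∩ (B ∩ Y) ∣
        ≡⟨ cong (_+ ∣ (A ∩ Y) ∩ (B ∩ Y) ∣) ∣Y∣≡3 ⟩
      3 + ∣ (A ∩ Y) ∩ (B ∩ Y) ∣
        ∎

  big-unique : ∀ (S : Split ⊤) {A B} → A ∈ᵖ S → B ∈ᵖ S →
               2 ≤ ∣ A ∩ Y ∣ → 2 ≤ ∣ B ∩ Y ∣ → A ≡ B
  big-unique S {A} {B} A∈S B∈S A-big B-big with ∈ᵖ-cases {S = S} A∈S B∈S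
  ... | inj₁ A≡B  = A≡B
  ... | inj₂ refl =
    let x , x∈ = big-meet {∁ B} {B} A-big B-big
        x∈∁B , x∈B = x∈p∩q⁻ (∁ B) B x∈
    in contradiction x∈B (x∈∁p⇒x∉p x∈∁B)

  majority : Split ⊤ → Subset n
  majority S = if maj (left S) Y then left S else right S

  majority-∈ᵖ : ∀ S → majority S ∈ᵖ S
  majority-∈ᵖ S with maj (left S) Y
  ... | true  = inj₁ refl
  ... | false = inj₂ refl

  majority-big : ∀ S → 2 ≤ ∣ majority S ∩ Y ∣
  majority-big S with maj (left S) Y in eq
  ... | true  = ≤ᵇ⇒≤ 2 _ (subst T (sym eq) tt)
  ... | false rewrite right≡∁left {S = S} = +-cancelˡ-≤ 1 2 _ (begin
    3                                         ≡⟨ ∣Y∣≡3 ⟨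
    ∣ Y ∣                                     ≡⟨ ∣p∩q∣+∣∁p∩q∣≡∣q∣ (left S) Y ⟨
    ∣ left S ∩ Y ∣ + ∣ ∁ (left S) ∩ Y ∣       ≤⟨ +-monoˡ-≤ _ left-small ⟩
    1 + ∣ ∁ (left S) ∩ Y ∣                    ∎)
    where
    open ≤-Reasoning
    left-small : ∣ left S ∩ Y ∣ ≤ 1
    left-small = ≤-pred
      (≰⇒> (λ 2≤ → subst T eq (≤⇒≤ᵇ 2≤)))

  module _ (𝒮 : SplitSystem n) where

    open Buneman 𝒮

    majorityVertex : Vertex
    majorityVertex = record
      { φ    = majority ∘ proj₁
      ; cong = λ S T S≈T → big-unique (proj₁ T)
          (∈ᵖ-resp {S = proj₁ S} {proj₁ T} S≈T (majority-∈ᵖ (proj₁ S))) (majority-∈ᵖ (proj₁ T))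
          (majority-big (proj₁ S)) (majority-big (proj₁ T))
      ; B1   = majority-∈ᵖ ∘ proj₁
      ; B2   = λ S T _ → big-meet (majority-big (proj₁ S)) (majority-big (proj₁ T))
      }

    majority-between : ∀ {x y} → x ∈ Y → y ∈ Y → x ≢ y → (S : Split ⊤) →
                       part S x ≡ part S y → majority S ≡ part S x
    majority-between {x} {y} x∈Y y∈Y x≢y S eq = big-unique S
      (majority-∈ᵖ S) (part-∈ᵖ S x) (majority-big S)
      (x≢y⇒2≤∣p∣ x≢y (x∈p∩q⁺ (∈-part S x , x∈Y))
        (x∈p∩q⁺ (subst (y ∈_) (sym eq) (∈-part S y) , y∈Y)))

maj-injective : ∀ {Y Y′ : Subset n} (S : Split ⊤) (h : ∣ Y ∣ ≡ 3) (h′ : ∣ Y′ ∣ ≡ 3) →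
                Majority.majority Y h S ≡ Majority.majority Y′ h′ S →
                maj (left S) Y ≡ maj (left S) Y′
maj-injective {Y = Y} {Y′} S _ _ eq with maj (left S) Y | maj (left S) Y′
... | true  | true  = refl
... | false | false = refl
... | true  | false = contradiction eq (left≢right {S = S})
... | false | true  = contradiction (sym eq) (left≢right {S = S})

Separating : SplitSystem n → Set
Separating {n} 𝒮 = (Y Y′ : Subset n) → ∣ Y ∣ ≡ 3 → ∣ Y′ ∣ ≡ 3 → Y ≢ Y′ →
  ∃ λ S → Member 𝒮 S × maj (left S) Y ≢ maj (left S) Y′

-- Medians of triples are majority vertices

module Medians (𝒮 : SplitSystem n) where

  open Geodesics 𝒮
  open Buneman 𝒮 renaming (cong to φ-cong)

  _++ʷ_ : ∀ {u v w} → Walk u v → Walk v w → Walk u w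
  stop u≈v  ++ʷ q = proj₁ (walk-respˡ u≈v q)
  step u~ p ++ʷ q = step u~ (p ++ʷ q)

  length-++ʷ : ∀ {u v w} (p : Walk u v) (q : Walk v w) →
               length (p ++ʷ q) ≡ length p + length q
  length-++ʷ (stop u≈v)  q = proj₂ (walk-respˡ u≈v q)
  length-++ʷ (step u~ p) q = cong suc (length-++ʷ p q)

  joint-LiesOn : ∀ {u v w} (p : Walk u v) (q : Walk v w) → v LiesOn (p ++ʷ q)
  joint-LiesOn (stop u≈v)  q = start-LiesOn (λ S → sym (u≈v S)) (proj₁ (walk-respˡ u≈v q))
  joint-LiesOn (step u~ p) q = inj₂ (joint-LiesOn p q)

  -- Direct walks from `u` to `m` and from `m` to `v` are joined. A split changed in both halves
  -- would take the same part at `u` and `v` but another at `m`, against betweenness; hence the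
  -- joined list of changes is distinct and certifies minimality.
  between⇒on-geodesic : ∀ {m u v} → (∀ S → φ u S ≡ φ v S → φ m S ≡ φ u S) →
                        OnShortestPath m u v
  between⇒on-geodesic {m} {u} {v} between
    with directWalk _ u m ≤-refl | directWalk _ m v ≤-refl
  ... | p , Rs , p≡Rs , Rs-dist , Rs-diff | q , Ts , q≡Ts , Ts-dist , Ts-diff =
    p ++ʷ q , shortest , joint-LiesOn p q
    where
    open ≤-Reasoning
    crossing : ∀ {R T} → Differ u m R → Differ m v T → ¬ (R ≈ᴱ T)
    crossing {R} {T} u≢m m≢v R≈T = u≢m (sym (between R
      (two-valued {S = proj₁ R} (B1 u R) (B1 m R) (B1 v R) u≢m
        (λ m≡v → m≢v (trans (sym (φ-cong m R T R≈T)) (trans m≡v (φ-cong v R T R≈T)))))))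
    distinct : Distinct (Rs ++ Ts)
    distinct = AllPairs.++⁺ Rs-dist Ts-dist
      (All.map (λ {R} u≢m → All.map (λ {T} m≢v → crossing {R} {T} u≢m m≢v) Ts-diff) Rs-diff)
    differ : All (Differ u v) (Rs ++ Ts)
    differ = All.++⁺
      (All.map (λ {R} u≢m u≡v → u≢m (sym (between R u≡v))) Rs-diff)
      (All.map (λ {T} m≢v u≡v → m≢v (trans (between T u≡v) u≡v)) Ts-diff)
    shortest : IsShortest (p ++ʷ q)
    shortest r = begin
      length (p ++ʷ q)                  ≡⟨ length-++ʷ p q ⟩
      length p + length q               ≡⟨ cong₂ _+_ p≡Rs q≡Ts ⟩
      List.length Rs + List.length Ts   ≡⟨ length-++ Rs ⟨
      List.length (Rs ++ Ts)            ≤⟨ distinct-differences≤length r distinct differ ⟩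
      length r                          ∎

  module _ (Y : Subset n) (∣Y∣≡3 : ∣ Y ∣ ≡ 3) where

    open Majority Y ∣Y∣≡3

    majorityVertex-isMedian : IsMedianOf (majorityVertex 𝒮) Y
    majorityVertex-isMedian = x , y , z , Y≡xyz ,
      geodesic-through (λ e → 0≢1 (injective e)) ,
      geodesic-through (λ e → 1≢2 (injective e)) ,
      geodesic-through (λ e → 0≢2 (injective e))
      where
      open Enumeration (subst (Enumeration Y) ∣Y∣≡3 (enumerate Y))
      geodesic-through : ∀ {i j} → at i ≢ at j →
        OnShortestPath (majorityVertex 𝒮) (vertexOf (at i)) (vertexOf (at j))
      geodesic-through i≢j =
        between⇒on-geodesic (λ S → majority-between 𝒮 (at∈ _) (at∈ _) i≢j (proj₁ S))
      x = at zero
      y = at (suc zero)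
      z = at (suc (suc zero))
      0≢1 : zero ≢ suc {2} zero
      0≢1 ()
      0≢2 : zero ≢ suc {2} (suc zero)
      0≢2 ()
      1≢2 : suc {2} zero ≢ suc (suc zero)
      1≢2 ()
      Y⊆xyz : Y ⊆ ⁅ x ⁆ ∪ ⁅ y ⁆ ∪ ⁅ z ⁆
      Y⊆xyz v∈Y with onto v∈Y
      ... | zero            , refl = x∈p∪q⁺ (inj₁ (x∈⁅x⁆ x))
      ... | suc zero        , refl = x∈p∪q⁺ (inj₂ (x∈p∪q⁺ (inj₁ (x∈⁅x⁆ y))))
      ... | suc (suc zero)  , refl = x∈p∪q⁺ (inj₂ (x∈p∪q⁺ (inj₂ (x∈⁅x⁆ z))))
      Y≡xyz : Y ≡ ⁅ x ⁆ ∪ ⁅ y ⁆ ∪ ⁅ z ⁆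
      Y≡xyz = ⊆-antisym Y⊆xyz (triple⊆ (at∈ _) (at∈ _) (at∈ _))

    median≈majorityVertex : ∀ {m} → IsMedianOf m Y → m ≈ⱽ majorityVertex 𝒮
    median≈majorityVertex {m} (x , y , z , refl , m-xy , m-yz , m-xz) S = same
      where
      S₁ = proj₁ S
      ∣xy∣≤2 : ∀ a b → ∣ ⁅ a ⁆ ∪ ⁅ b ⁆ ∣ ≤ 2
      ∣xy∣≤2 a b = ≤-trans (m+n≤o⇒m≤o _ (≤-reflexive (∣p∪q∣+∣p∩q∣≡∣p∣+∣q∣ ⁅ a ⁆ ⁅ b ⁆)))
        (≤-reflexive (cong₂ _+_ (∣⁅x⁆∣≡1 a) (∣⁅x⁆∣≡1 b)))
      -- `IsMedianOf` names `x`, `y`, `z` without saying that they are distinct; a coincidence would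
      -- squeeze three elements into a pair.
      not-pair : ∀ a b → ¬ (⁅ x ⁆ ∪ ⁅ y ⁆ ∪ ⁅ z ⁆ ⊆ ⁅ a ⁆ ∪ ⁅ b ⁆)
      not-pair a b Y⊆ab = contradiction (∣xy∣≤2 a b)
        (<⇒≱ (≤-trans (≤-reflexive (sym ∣Y∣≡3)) (p⊆q⇒∣p∣≤∣q∣ Y⊆ab)))
      a∈ab : ∀ {a b} → a ∈ ⁅ a ⁆ ∪ ⁅ b ⁆
      a∈ab {a} = x∈p∪q⁺ (inj₁ (x∈⁅x⁆ a))
      b∈ab : ∀ {a b} → b ∈ ⁅ a ⁆ ∪ ⁅ b ⁆
      b∈ab {a} {b} = x∈p∪q⁺ (inj₂ (x∈⁅x⁆ b))
      x≢y : x ≢ y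
      x≢y refl = not-pair x z (triple⊆ a∈ab a∈ab b∈ab)
      x≢z : x ≢ z
      x≢z refl = not-pair x y (triple⊆ a∈ab b∈ab a∈ab)
      y≢z : y ≢ z
      y≢z refl = not-pair x y (triple⊆ a∈ab b∈ab b∈ab)
      x∈Y : x ∈ ⁅ x ⁆ ∪ ⁅ y ⁆ ∪ ⁅ z ⁆
      x∈Y = x∈p∪q⁺ (inj₁ (x∈⁅x⁆ x))
      y∈Y : y ∈ ⁅ x ⁆ ∪ ⁅ y ⁆ ∪ ⁅ z ⁆
      y∈Y = x∈p∪q⁺ (inj₂ a∈ab)
      z∈Y : z ∈ ⁅ x ⁆ ∪ ⁅ y ⁆ ∪ ⁅ z ⁆
      z∈Y = x∈p∪q⁺ (inj₂ b∈ab)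
      same : φ m S ≡ majority S₁
      -- Two of the three points share a part of `S`, and `m` lies on a geodesic between those two.
      same with part S₁ x ≟ˢ part S₁ y | part S₁ y ≟ˢ part S₁ z
      ... | yes eq | _      = trans (on-geodesic⇒between {m} m-xy S eq)
        (sym (majority-between 𝒮 x∈Y y∈Y x≢y S₁ eq))
      ... | no _   | yes eq = trans (on-geodesic⇒between {m} m-yz S eq)
        (sym (majority-between 𝒮 y∈Y z∈Y y≢z S₁ eq))
      ... | no neq | no neq′ =
        let eq = two-valued {S = S₁} (part-∈ᵖ S₁ x) (part-∈ᵖ S₁ y) (part-∈ᵖ S₁ z) neq neq′ in
        trans (on-geodesic⇒between {m} m-xz S eq)
          (sym (majority-between 𝒮 x∈Y z∈Y x≢z S₁ eq))

  injective⇒separating : Injective 𝒮 → Separating 𝒮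
  injective⇒separating inj Y Y′ h h′ Y≢Y′
    -- Only finitely many splits need testing: either one separates, or the two majority vertices
    -- agree, against injectivity.
    with Any.any? (λ S → ¬? (maj (left (proj₁ S)) Y ≟ᵇ maj (left (proj₁ S)) Y′)) elements
  ... | yes some = let (S , S∈𝒮) , sep = Any.satisfied some in S , S∈𝒮 , sep
  ... | no  none = contradiction
    (∀elements⇒∀ (λ S → M S ≡ M′ S)
      (λ S T S≈T eq → trans (φ-cong (Majority.majorityVertex Y h 𝒮) S T S≈T)
        (trans eq (sym (φ-cong (Majority.majorityVertex Y′ h′ 𝒮) S T S≈T))))
      (All.map (λ {S} ¬sep → M-cong S (decidable-stable (_ ≟ᵇ _) ¬sep))
        (All.¬Any⇒All¬ elements none)))
    (inj Y Y′ h h′ Y≢Y′ (Majority.majorityVertex Y h 𝒮) (Majority.majorityVertex Y′ h′ 𝒮)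
      (majorityVertex-isMedian Y h) (majorityVertex-isMedian Y′ h′))
    where
    M  = φ (Majority.majorityVertex Y h 𝒮)
    M′ = φ (Majority.majorityVertex Y′ h′ 𝒮)
    M-cong : ∀ S → maj (left (proj₁ S)) Y ≡ maj (left (proj₁ S)) Y′ → M S ≡ M′ S
    M-cong S = cong (if_then left (proj₁ S) else right (proj₁ S))

  separating⇒injective : Separating 𝒮 → Injective 𝒮
  separating⇒injective sep Y Y′ h h′ Y≢Y′ m m′ m-med m′-med m≈m′
    with sep Y Y′ h h′ Y≢Y′
  ... | S , S∈𝒮 , maj≢ = maj≢ (maj-injective S h h′
    (trans (sym (median≈majorityVertex Y h {m} m-med (S , S∈𝒮)))
      (trans (m≈m′ (S , S∈𝒮)) (median≈majorityVertex Y′ h′ {m′} m′-med (S , S∈𝒮)))))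

-- Goal holds of some set of labels satisfying H as soon as H meets every
-- clause: pick an element of H from the first clause not yet met, trying its
-- elements in turn and remembering those outside H.
module Search {Goal : List ℕ → Set} (goal? : Decidable Goal) where

  infix 4 _∈ᵇ_

  _∈ᵇ_ : ℕ → List ℕ → Bool
  m ∈ᵇ ms = any (m ≡ᵇ_) ms

  mutual
    search : (clauses : List (List ℕ)) (chosen rejected : List ℕ) → Bool
    -- All clauses are met without reaching the goal, so nothing is proved.
    search []       ps qs = false
    search (c ∷ cs) ps qs =
      if any (_∈ᵇ ps) c then search cs ps qs else branch c cs ps qs

    branch : List ℕ → (clauses : List (List ℕ)) (chosen rejected : List ℕ) → Bool
    -- Every element of the clause is rejected, so no `H` meeting it is left to consider.
    branch []      cs ps qs = true
    branch (p ∷ c) cs ps qs =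
      if p ∈ᵇ qs then branch c cs ps qs
      else (does (goal? (p ∷ ps)) ∨ search cs (p ∷ ps) qs) ∧ branch c cs ps (p ∷ qs)

  module _ {H : ℕ → Set} (H? : Decidable H) where

    rejected⇒¬H : ∀ {p qs} → All (¬_ ∘ H) qs → T (p ∈ᵇ qs) → ¬ H p
    rejected⇒¬H {p} ¬Hqs p∈qs Hp with All.lookupAny ¬Hqs (any⁻ (p ≡ᵇ_) _ p∈qs)
    ... | ¬Hq , p≡q = ¬Hq (subst H (≡ᵇ⇒≡ p _ p≡q) Hp)

    mutual
      search-sound : ∀ cs ps qs → T (search cs ps qs) → All H ps → All (¬_ ∘ H) qs →
                     All (Any H) cs → ∃ λ rs → All H rs × Goal rs
      search-sound (c ∷ cs) ps qs ok Hps ¬Hqs (Hc ∷ Hcs) with any (_∈ᵇ ps) c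
      ... | true  = search-sound cs ps qs ok Hps ¬Hqs Hcs
      ... | false = branch-sound c cs ps qs ok Hps ¬Hqs Hc Hcs

      branch-sound : ∀ c cs ps qs → T (branch c cs ps qs) → All H ps → All (¬_ ∘ H) qs →
                     Any H c → All (Any H) cs → ∃ λ rs → All H rs × Goal rs
      branch-sound (p ∷ c) cs ps qs ok Hps ¬Hqs Hc Hcs with p ∈ᵇ qs in eq
      ... | true = branch-sound c cs ps qs ok Hps ¬Hqs
        (Any.tail (rejected⇒¬H ¬Hqs (subst T (sym eq) tt)) Hc) Hcs
      ... | false with goal? (p ∷ ps) | H? p
      ...   | yes g | yes Hp = p ∷ ps , Hp ∷ Hps , g
      ...   | yes _ | no ¬Hp =
        branch-sound c cs ps (p ∷ qs) ok Hps (¬Hp ∷ ¬Hqs) (Any.tail ¬Hp Hc) Hcs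
      ...   | no _  | yes Hp = search-sound cs (p ∷ ps) qs
        (proj₁ (Equivalence.to (T-∧ {search cs (p ∷ ps) qs}) ok)) (Hp ∷ Hps) ¬Hqs Hcs
      ...   | no _  | no ¬Hp = branch-sound c cs ps (p ∷ qs)
        (proj₂ (Equivalence.to (T-∧ {search cs (p ∷ ps) qs}) ok))
        Hps (¬Hp ∷ ¬Hqs) (Any.tail ¬Hp Hc) Hcs

-- Patterns: the traces of splits on Fin k, up to complement

infix 4 _~_ _~?_

_~_ : Subset k → Subset k → Set
p ~ q = p ≡ q ⊎ p ≡ ∁ q

_~?_ : (p q : Subset k) → Dec (p ~ q)
p ~? q = p ≟ˢ q ⊎-dec p ≟ˢ ∁ q

Separates : Subset k → Subset k → Subset k → Set
Separates P Q p = maj p P ≢ maj p Q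

separates? : (P Q : Subset k) → Decidable (Separates P Q)
separates? P Q p = ¬? (maj p P ≟ᵇ maj p Q)

size± : Subset k → ℕ
size± p = ∣ p ∣ ⊓ ∣ ∁ p ∣

triples : ∀ k → List (Subset k)
triples k = filter (λ P → ∣ P ∣ ≟ⁿ 3) (subsets k)

-- One of each two complementary patterns of size r, namely the one containing zero.
patterns : ∀ k → ℕ → List (Subset (suc k))
patterns k r = filter (λ p → size± p ≟ⁿ r) (List.map (inside ∷_) (subsets k))

-- Patterns are named by their positions, so that the search compares numbers instead of subsets.
decode : List (Subset k) → ℕ → Subset k
decode []       _       = ⊥
decode (p ∷ ps) zero    = p
decode (p ∷ ps) (suc m) = decode ps m

labels : List (Subset k) → List ℕ
labels ps = List.upTo (List.length ps)

-- `os` lists the intersection sizes of the pairs of triples that contribute a clause.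
overlap? : (os : List ℕ) (P : Subset k) → Decidable (λ Q → ∣ P ∩ Q ∣ ∈ˡ os)
overlap? os P Q = ∣ P ∩ Q ∣ ∈ⁿ? os

-- The lists of triples and labels are arguments so that they are computed once.
clausesOver : List (Subset k) → List ℕ → List (Subset k) → List ℕ → List (List ℕ)
clausesOver ps os ts ms =
  concatMap (λ P → List.map (λ Q → filter (separates? P Q ∘ decode ps) ms)
                     (filter (overlap? os P) ts)) ts

clauses : List (Subset k) → List ℕ → List (List ℕ)
clauses ps os = clausesOver ps os (triples _) (labels ps)

Family : ℕ → ℕ → List (Subset k) → Set
Family t r ps = t ≤ List.length ps × AllPairs (λ p q → ¬ (p ~ q)) ps × All (λ p → size± p ≡ r) ps

family? : ∀ t r → Decidable (Family {k} t r)
family? t r ps = t ≤? List.length ps ×-dec allPairs? (λ p q → ¬? (p ~? q)) ps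
                   ×-dec All.all? (λ p → size± p ≟ⁿ r) ps

pair : Fin k → Fin k → Subset k
pair x y = ⁅ x ⁆ ∪ ⁅ y ⁆

-- The edges of each triangle are converted to labels in advance, which keeps the goal test
-- numerical. That each resulting list of labels really contains a triangle is checked separately by
-- `AllTriangles`.
triangles : (List (Subset k)) → List (List ℕ)
triangles {k} table =
  concatMap (λ x → concatMap (λ y → List.map (λ z → code x y ++ code x z ++ code y z)
    (filter (y <ᶠ?_) xs)) (filter (x <ᶠ?_) xs)) xs
  where
  xs = List.allFin k
  code = λ x y → filter (λ m → decode table m ~? pair x y) (labels table)

MeetsTriangle : List (List ℕ) → List ℕ → Set
MeetsTriangle ts ms = T (any (all (λ m → any (m ≡ᵇ_) ms)) ts)

meetsTriangle? : ∀ ts → Decidable (MeetsTriangle ts)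
meetsTriangle? ts ms = T? _

Triangle : List (Subset k) → Set
Triangle ps = ∃ λ x → ∃ λ y → Edge x y × ∃ λ z → Edge x z × Edge y z
  where Edge = λ x y → x ≢ y × Any (_~ pair x y) ps

triangle? : Decidable (Triangle {k})
triangle? ps = anyᶠ? λ x → anyᶠ? λ y → edge? x y ×-dec anyᶠ? λ z → edge? x z ×-dec edge? y z
  where edge? = λ x y → ¬? (x ≟ᶠ y) ×-dec Any.any? (_~? pair x y) ps

-- Finite verifications on four, five and six points

familySearch : ℕ → List (Subset k) → List ℕ → Bool
familySearch t ps os =
  Search.search (family? t 2 ∘ List.map (decode ps)) (clauses ps os) [] []

triangleSearch : List (Subset k) → List ℕ → Bool
triangleSearch ps os = Search.search (meetsTriangle? (triangles ps)) (clauses ps os) [] []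

-- Two triples are separated by exactly the two 2-splits that cut their common pair, so each single
-- one of the three 2-splits leaves some clause unmet.
familySearch₄ : T (familySearch 2 (patterns 3 2) (2 ∷ []))
familySearch₄ = tt

familySearch₅ : T (familySearch 5 (patterns 4 2) (1 ∷ 2 ∷ []))
familySearch₅ = tt

-- Pairs of triples meeting in one point are not needed on 6 points; leaving
-- them out makes the search much shorter.
triangleSearch₆ : T (triangleSearch (patterns 5 2) (0 ∷ 2 ∷ []))
triangleSearch₆ = tt

AllTriangles : List (Subset k) → Set
AllTriangles ps = All (Triangle ∘ List.map (decode ps)) (triangles ps)

allTriangles₆ : AllTriangles (patterns 5 2)
allTriangles₆ = toWitness {a? = All.all? (triangle? ∘ List.map (decode (patterns 5 2))) _} tt

PairSizes : ℕ → Set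
PairSizes k = (x y : Fin k) → x ≢ y → size± (pair x y) ≡ 2

pairSizes₆ : PairSizes 6
pairSizes₆ = toWitness {a? = all? λ x → all? λ y → ¬? (x ≟ᶠ y) →-dec (size± (pair x y) ≟ⁿ 2)} tt

FewFail : ℕ → ℕ → ℕ → Set
FewFail k r t = All (λ P → All (λ Q → P ∪ Q ≡ ⊤ →
  List.length (filter (¬? ∘ separates? P Q) (patterns k r)) < t)
  (triples (suc k))) (triples (suc k))

fewFail? : ∀ k r t → Dec (FewFail k r t)
fewFail? k r t = All.all? (λ P → All.all? (λ Q → (P ∪ Q ≟ˢ ⊤) →-dec
  (List.length (filter (¬? ∘ separates? P Q) (patterns k r)) <? t)) _) _

-- The only failure is the 2-split with the common pair of the triples as a part.
fewFail₄ : FewFail 3 2 2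
fewFail₄ = toWitness {a? = fewFail? 3 2 2} tt

-- The failures are the four pairs joining a point of `P` alone to a point of `Q` alone.
fewFail₅ : FewFail 4 2 5
fewFail₅ = toWitness {a? = fewFail? 4 2 5} tt

-- The triples are complementary: if three points include at least two of `P`, they include at most
-- one of `Q`, and conversely, so every 3-split separates.
fewFail₆ : FewFail 5 3 1
fewFail₆ = toWitness {a? = fewFail? 5 3 1} tt

TriangleSeparates : Subset k → Subset k → Set
TriangleSeparates P Q = ∀ x y z → x ≢ y → x ≢ z → y ≢ z →
  Separates P Q (pair x y) ⊎ Separates P Q (pair x z) ⊎ Separates P Q (pair y z)

triangleSeparates? : (P Q : Subset k) → Dec (TriangleSeparates P Q)
triangleSeparates? P Q = all? λ x → all? λ y → all? λ z →
  ¬? (x ≟ᶠ y) →-dec ¬? (x ≟ᶠ z) →-dec ¬? (y ≟ᶠ z) →-dec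
  (separates? P Q (pair x y) ⊎-dec separates? P Q (pair x z) ⊎-dec separates? P Q (pair y z))

TrianglesSeparate : ℕ → Set
TrianglesSeparate k =
  All (λ P → All (λ Q → P ∪ Q ≡ ⊤ → TriangleSeparates P Q) (triples k)) (triples k)

-- Two of `x`, `y`, `z` fall into the same one of the two disjoint triples, and that pair separates.
trianglesSeparate₆ : TrianglesSeparate 6
trianglesSeparate₆ = toWitness {a? = All.all? (λ P → All.all? (λ Q →
  (P ∪ Q ≟ˢ ⊤) →-dec triangleSeparates? P Q) _) _} tt

Sizes : ℕ → List ℕ → Set
Sizes k rs = All (λ p → 2 ≤ size± p → size± p ∈ˡ rs) (subsets k)

sizes? : ∀ k rs → Dec (Sizes k rs)
sizes? k rs = All.all? (λ p → (2 ≤? size± p) →-dec (size± p ∈ⁿ? rs)) _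

sizes₄ : Sizes 4 (2 ∷ [])
sizes₄ = toWitness {a? = sizes? 4 (2 ∷ [])} tt

sizes₅ : Sizes 5 (2 ∷ [])
sizes₅ = toWitness {a? = sizes? 5 (2 ∷ [])} tt

sizes₆ : Sizes 6 (2 ∷ 3 ∷ [])
sizes₆ = toWitness {a? = sizes? 6 (2 ∷ 3 ∷ [])} tt

-- Patterns up to complement and their sizes

~-refl : {p : Subset k} → p ~ p
~-refl = inj₁ refl

~-sym : {p q : Subset k} → p ~ q → q ~ p
~-sym (inj₁ p≡q)          = inj₁ (sym p≡q)
~-sym {q = q} (inj₂ refl) = inj₂ (sym (∁-involutive q))

~-trans : {p q r : Subset k} → p ~ q → q ~ r → p ~ r
~-trans (inj₁ refl) q~r         = q~r
~-trans (inj₂ refl) (inj₁ refl) = inj₂ refl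
~-trans {r = r} (inj₂ refl) (inj₂ refl) = inj₁ (∁-involutive r)

size±-resp : {p q : Subset k} → p ~ q → size± p ≡ size± q
size±-resp (inj₁ refl) = refl
size±-resp {q = q} (inj₂ refl) =
  trans (cong (λ p → ∣ ∁ q ∣ ⊓ ∣ p ∣) (∁-involutive q)) (⊓-comm ∣ ∁ q ∣ ∣ q ∣)

maj-∁ : (p P : Subset k) → ∣ P ∣ ≡ 3 → maj (∁ p) P ≡ not (maj p P)
maj-∁ p P ∣P∣≡3 = go ∣ p ∩ P ∣ ∣ ∁ p ∩ P ∣ (trans (∣p∩q∣+∣∁p∩q∣≡∣q∣ p P) ∣P∣≡3)
  where
  go : ∀ a b → a + b ≡ 3 → (2 ≤ᵇ b) ≡ not (2 ≤ᵇ a)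
  go 0 .3 refl = refl
  go 1 .2 refl = refl
  go 2 .1 refl = refl
  go 3 .0 refl = refl

maj⇒2≤∣p∣ : (p P : Subset k) → maj p P ≡ true → 2 ≤ ∣ p ∣
maj⇒2≤∣p∣ p P eq = ≤-trans (≤ᵇ⇒≤ 2 _ (subst T (sym eq) tt)) (∣p∩q∣≤∣p∣ p P)

module _ (P Q : Subset k) (∣P∣≡3 : ∣ P ∣ ≡ 3) (∣Q∣≡3 : ∣ Q ∣ ≡ 3) where

  separates-resp : {p q : Subset k} → p ~ q → Separates P Q p → Separates P Q q
  separates-resp (inj₁ refl) sep = sep
  separates-resp {q = q} (inj₂ refl) sep eq = sep (begin
    maj (∁ q) P   ≡⟨ maj-∁ q P ∣P∣≡3 ⟩
    not (maj q P) ≡⟨ cong not eq ⟩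
    not (maj q Q) ≡⟨ maj-∁ q Q ∣Q∣≡3 ⟨
    maj (∁ q) Q   ∎)
    where open ≡-Reasoning

  -- Each of the two parts is the majority part of one of the triples. Trivial splits therefore
  -- never separate.
  separates⇒2≤size± : {p : Subset k} → Separates P Q p → 2 ≤ size± p
  separates⇒2≤size± {p} sep with maj p P in eqP | maj p Q in eqQ
  ... | true  | true  = contradiction refl sep
  ... | false | false = contradiction refl sep
  ... | true  | false = ⊓-glb (maj⇒2≤∣p∣ p P eqP)
    (maj⇒2≤∣p∣ (∁ p) Q (trans (maj-∁ p Q ∣Q∣≡3) (cong not eqQ)))
  ... | false | true  = ⊓-glb (maj⇒2≤∣p∣ p Q eqQ)
    (maj⇒2≤∣p∣ (∁ p) P (trans (maj-∁ p P ∣P∣≡3) (cong not eqP)))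

patterns-complete : ∀ {r} (p : Subset (suc k)) → size± p ≡ r → ∃ λ q → q ∈ˡ patterns k r × p ~ q
patterns-complete (inside ∷ p) eq =
  inside ∷ p , ∈-filter⁺ _ (∈-map⁺ (inside ∷_) (∈-subsets p)) eq , ~-refl
patterns-complete (outside ∷ p) eq =
  inside ∷ ∁ p , ∈-filter⁺ _ (∈-map⁺ (inside ∷_) (∈-subsets (∁ p)))
    (trans (sym (size±-resp p~q)) eq) , p~q
  where
  p~q : outside ∷ p ~ inside ∷ ∁ p
  p~q = inj₂ (cong (outside ∷_) (sym (∁-involutive p)))

decode-surjective : {ps : List (Subset k)} {p : Subset k} → p ∈ˡ ps →
                    ∃ λ m → m < List.length ps × decode ps m ≡ p
decode-surjective (here refl) = zero , s≤s z≤n , refl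
decode-surjective (there p∈)  =
  let m , m< , eq = decode-surjective p∈ in suc m , s≤s m< , eq

AllPairs-lookup : {A : Set} {R : A → A → Set} → (∀ {x y} → R x y → R y x) → {xs : List A} →
                  AllPairs R xs → ∀ i j → i ≢ j → R (List.lookup xs i) (List.lookup xs j)
AllPairs-lookup R-sym (Rx ∷ Rxs) zero    zero    i≢j = contradiction refl i≢j
AllPairs-lookup R-sym (Rx ∷ Rxs) zero    (suc j) i≢j = All.lookup Rx (∈-lookup j)
AllPairs-lookup R-sym (Rx ∷ Rxs) (suc i) zero    i≢j = R-sym (All.lookup Rx (∈-lookup i))
AllPairs-lookup R-sym (Rx ∷ Rxs) (suc i) (suc j) i≢j =
  AllPairs-lookup R-sym Rxs i j (i≢j ∘ cong suc)

-- Traces of the split system on a subset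

module Traces (𝒮 : SplitSystem n) (U : Subset n) (en : Enumeration U k) where

  open Enumeration en renaming (at to pt)
  open Geodesics 𝒮 using (elements; elements-complete)
  open Buneman 𝒮 using (Element; _≈ᴱ_)

  trace : Subset n → Subset k
  trace = preimage pt

  trace-U : trace U ≡ ⊤
  trace-U = ⊆-antisym ⊆⊤ (λ {i} _ → ∈-preimage⁺ pt U (at∈ i))

  trace-∩U : ∀ A → trace (A ∩ U) ≡ trace A
  trace-∩U A = trans (preimage-∩ pt A U) (trans (cong (trace A ∩_) trace-U) (∩-identityʳ (trace A)))

  trace-injective : ∀ {A B} → A ⊆ U → B ⊆ U → trace A ≡ trace B → A ≡ B
  trace-injective A⊆U B⊆U eq = ⊆-antisym (half A⊆U eq) (half B⊆U (sym eq))
    where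
    half : ∀ {A B} → A ⊆ U → trace A ≡ trace B → A ⊆ B
    half {A} {B} A⊆U eq x∈A with onto (A⊆U x∈A)
    ... | i , refl = ∈-preimage⁻ pt B (subst (i ∈_) eq (∈-preimage⁺ pt A x∈A))

  ∣trace∣ : ∀ {A} → A ⊆ U → ∣ trace A ∣ ≡ ∣ A ∣
  ∣trace∣ A⊆U = ∣preimage∣ pt injective (λ x∈A → onto (A⊆U x∈A))

  trace-maj : ∀ A {Y} → Y ⊆ U → maj A Y ≡ maj (trace A) (trace Y)
  trace-maj A {Y} Y⊆U = cong (2 ≤ᵇ_) (trans
    (sym (∣trace∣ (λ x∈ → Y⊆U (p∩q⊆q A Y x∈)))) (cong ∣_∣ (preimage-∩ pt A Y)))

  left⊆ : (T : Split U) → left T ⊆ U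
  left⊆ T = subst (left T ⊆_) (covers T) (p⊆p∪q (right T))

  right⊆ : (T : Split U) → right T ⊆ U
  right⊆ T = subst (right T ⊆_) (covers T) (q⊆p∪q (left T) (right T))

  trace-right : (T : Split U) → trace (right T) ≡ ∁ (trace (left T))
  trace-right T = ⊆-antisym
    (λ i∈ → x∉p⇒x∈∁p (λ i∈l → disjoint T (_ , x∈p∩q⁺
      (∈-preimage⁻ pt (left T) i∈l , ∈-preimage⁻ pt (right T) i∈))))
    (λ {i} i∈ → [ (λ i∈l → contradiction (∈-preimage⁺ pt (left T) i∈l) (x∈∁p⇒x∉p i∈))
                , ∈-preimage⁺ pt (right T) ]′
      (x∈p∪q⁻ (left T) (right T) (subst (pt i ∈_) (sym (covers T)) (at∈ i))))

  traceˢ : Split U → Subset k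
  traceˢ T = trace (left T)

  ~⇒HasParts : (T : Split U) {A B : Subset n} → A ⊆ U → B ⊆ U → trace B ≡ ∁ (trace A) →
               traceˢ T ~ trace A → T HasParts A , B
  ~⇒HasParts T A⊆U B⊆U B≡∁A (inj₁ l≡A) = inj₁
    ( trace-injective (left⊆ T) A⊆U l≡A
    , trace-injective (right⊆ T) B⊆U (trans (trace-right T) (trans (cong ∁ l≡A) (sym B≡∁A))))
  ~⇒HasParts T {A} A⊆U B⊆U B≡∁A (inj₂ l≡∁A) = inj₂
    ( trace-injective (left⊆ T) B⊆U (trans l≡∁A (sym B≡∁A))
    , trace-injective (right⊆ T) A⊆U
        (trans (trace-right T) (trans (cong ∁ l≡∁A) (∁-involutive (trace A)))))

  HasParts⇒~ : (T : Split U) {A B : Subset n} → trace B ≡ ∁ (trace A) →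
               T HasParts A , B → traceˢ T ~ trace A
  HasParts⇒~ T B≡∁A (inj₁ (refl , _)) = inj₁ refl
  HasParts⇒~ T B≡∁A (inj₂ (refl , _)) = inj₂ B≡∁A

  size-trace : (T : Split U) → size T ≡ size± (traceˢ T)
  size-trace T = cong₂ _⊓_ (sym (∣trace∣ (left⊆ T)))
    (trans (sym (∣trace∣ (right⊆ T))) (cong ∣_∣ (trace-right T)))

  trace-right⊤ : (S : Split (⊤ {n})) → trace (right S) ≡ ∁ (trace (left S))
  trace-right⊤ S = trans (cong trace (right≡∁left {S = S})) (preimage-∁ pt (left S))

  trace-rightU : (S : Split (⊤ {n})) → trace (right S ∩ U) ≡ ∁ (trace (left S ∩ U))
  trace-rightU S = trans (trace-∩U (right S))
    (trans (trace-right⊤ S) (cong ∁ (sym (trace-∩U (left S)))))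

  Has : Subset k → Set
  Has p = ∃ λ S → Member 𝒮 S × trace (left S) ~ p

  has? : Decidable Has
  has? p with Any.any? (λ S → trace (left (proj₁ S)) ~? p) elements
  ... | yes some = let (S , S∈𝒮) , eq = Any.satisfied some in yes (S , S∈𝒮 , eq)
  ... | no  none = no λ (S , S∈𝒮 , S~p) → none
    (Any.map (λ {T} S≈T → ~-trans (~-sym (left~ S (proj₁ T) S≈T)) S~p)
      (elements-complete (S , S∈𝒮)))
    where
    left~ : (S T : Split ⊤) → S ≈ T → trace (left S) ~ trace (left T)
    left~ S T (inj₁ (refl , _)) = ~-refl
    left~ S T (inj₂ (refl , _)) = inj₂ (trace-right⊤ T)

  restricted⇒has : (T : Split U) → (𝒮 ∣ʳ U) T → Has (traceˢ T)
  restricted⇒has T (S , S∈𝒮 , parts) = S , S∈𝒮 , ~-sym (subst (traceˢ T ~_) (trace-∩U (left S))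
    (HasParts⇒~ T (trace-rightU S) parts))

  has⇒restricted : ∀ {p} → Has p → 1 ≤ size± p → Σ (Split U) λ T → (𝒮 ∣ʳ U) T × traceˢ T ~ p
  has⇒restricted {p} (S , S∈𝒮 , S~p) 1≤ = record
    { left      = left S ∩ U
    ; right     = right S ∩ U
    ; nonemptyˡ = nonempty (left S) (m≤n⊓o⇒m≤n _ _ 1≤′)
    ; nonemptyʳ = nonempty (right S)
        (subst (λ q → 1 ≤ ∣ q ∣) (sym (trace-right⊤ S)) (m≤n⊓o⇒m≤o ∣ trace (left S) ∣ _ 1≤′))
    ; disjoint  = λ (x , x∈) → let x∈l , x∈r = x∈p∩q⁻ (left S ∩ U) _ x∈ in
        disjoint S (x , x∈p∩q⁺ (p∩q⊆p (left S) U x∈l , p∩q⊆p (right S) U x∈r))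
    ; covers    = trans (sym (∩-distribʳ-∪ U (left S) (right S)))
        (trans (cong (_∩ U) (covers S)) (∩-identityˡ U))
    } , (S , S∈𝒮 , inj₁ (refl , refl)) , subst (_~ p) (sym (trace-∩U (left S))) S~p
    where
    1≤′ : 1 ≤ size± (trace (left S))
    1≤′ = subst (1 ≤_) (sym (size±-resp S~p)) 1≤
    nonempty : ∀ A → 1 ≤ ∣ trace A ∣ → Nonempty (A ∩ U)
    nonempty A 1≤ = let i , i∈ = 0<∣p∣⇒Nonempty (trace A) 1≤ in
      pt i , x∈p∩q⁺ (∈-preimage⁻ pt A i∈ , at∈ i)

  family⇒atLeast : ∀ {t r ps} → 1 ≤ r → Family t r ps → All Has ps →
                   AtLeast t [ r ]-splitsIn (𝒮 ∣ʳ U)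
  family⇒atLeast {t} {r} {ps} 1≤r (t≤ , distinct , sizes) hps = proj₁ ∘ split , good , inj
    where
    member : Fin t → Subset k
    member i = List.lookup ps (inject≤ i t≤)
    size-member : ∀ i → size± (member i) ≡ r
    size-member i = All.lookup sizes (∈-lookup (inject≤ i t≤))
    split : ∀ i → Σ (Split U) λ T → (𝒮 ∣ʳ U) T × traceˢ T ~ member i
    split i = has⇒restricted (All.lookup hps (∈-lookup (inject≤ i t≤)))
      (subst (1 ≤_) (sym (size-member i)) 1≤r)
    good : ∀ i → (𝒮 ∣ʳ U) (proj₁ (split i)) × size (proj₁ (split i)) ≡ r
    good i = let T , T∈ , T~ = split i in
      T∈ , trans (size-trace T) (trans (size±-resp T~) (size-member i))
    inj : ∀ i j → proj₁ (split i) ≈ proj₁ (split j) → i ≡ j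
    inj i j eq = decidable-stable (i ≟ᶠ j) λ i≢j →
      let Tᵢ , _ , ~i = split i
          Tⱼ , _ , ~j = split j
      in AllPairs-lookup (λ ¬p~q q~p → ¬p~q (~-sym q~p)) distinct
           (inject≤ i t≤) (inject≤ j t≤) (i≢j ∘ inject≤-injective t≤ t≤ i j)
           (~-trans (~-sym ~i) (~-trans (HasParts⇒~ Tᵢ (trace-right Tⱼ) eq) ~j))

  trace-singleton : ∀ i → trace ⁅ pt i ⁆ ≡ ⁅ i ⁆
  trace-singleton i = ⊆-antisym
    (λ j∈ → subst (_∈ ⁅ i ⁆)
      (injective (sym (x∈⁅y⁆⇒x≡y (pt i) (∈-preimage⁻ pt _ j∈)))) (x∈⁅x⁆ i))
    (λ j∈ → ∈-preimage⁺ pt _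
      (subst (λ l → pt l ∈ ⁅ pt i ⁆) (sym (x∈⁅y⁆⇒x≡y i j∈)) (x∈⁅x⁆ (pt i))))

  trace-pair : ∀ i j → trace (pair (pt i) (pt j)) ≡ pair i j
  trace-pair i j = trans (preimage-∪ pt ⁅ pt i ⁆ ⁅ pt j ⁆)
    (cong₂ _∪_ (trace-singleton i) (trace-singleton j))

  pair⊆U : ∀ i j → pair (pt i) (pt j) ⊆ U
  pair⊆U i j x∈ with x∈p∪q⁻ ⁅ pt i ⁆ _ x∈
  ... | inj₁ x∈i = subst (_∈ U) (sym (x∈⁅y⁆⇒x≡y _ x∈i)) (at∈ i)
  ... | inj₂ x∈j = subst (_∈ U) (sym (x∈⁅y⁆⇒x≡y _ x∈j)) (at∈ j)

  trace-─ : ∀ A → trace (U ─ A) ≡ ∁ (trace A)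
  trace-─ A = ⊆-antisym
    (λ {i} i∈ → x∉p⇒x∈∁p (λ i∈A → ∉-─ (∈-preimage⁻ pt A i∈A) (∈-preimage⁻ pt (U ─ A) i∈)))
    (λ {i} i∈ → ∈-preimage⁺ pt (U ─ A) (x∈p∧x∉q⇒x∈p─q (at∈ i)
      (λ ∈A → x∈∁p⇒x∉p i∈ (∈-preimage⁺ pt A ∈A))))
    where
    ∉-─ : ∀ {x} → x ∈ A → x ∉ U ─ A
    -- Deleting `A` a second time leaves `U ─ A` unchanged, yet would shrink it if it contained a
    -- point of `A`.
    ∉-─ {x} x∈A x∈─ = <⇒≱ (p∩q≢∅⇒∣p─q∣<∣p∣ (U ─ A) A (x , x∈p∩q⁺ (x∈─ , x∈A)))
      (≤-reflexive (cong ∣_∣ (sym (p─q─q≡p─q U A))))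

  has⇒pairSplit : ∀ {i j} → size± (pair i j) ≡ 2 → Has (pair i j) →
                  HasPairSplit (𝒮 ∣ʳ U) (pt i) (pt j)
  has⇒pairSplit {i} {j} size≡2 h =
    let T , T∈ , T~ = has⇒restricted h (subst (1 ≤_) (sym size≡2) (s≤s z≤n)) in
    T , T∈ , trans (size-trace T) (trans (size±-resp T~) size≡2) ,
    ~⇒HasParts T (pair⊆U i j) (p─q⊆p U _) (trace-─ _)
      (subst (traceˢ T ~_) (sym (trace-pair i j)) T~)

  pairSplit⇒has : ∀ {i j} → HasPairSplit (𝒮 ∣ʳ U) (pt i) (pt j) → Has (pair i j)
  pairSplit⇒has {i} {j} (T , T∈ , _ , parts) =
    let S , S∈𝒮 , S~T = restricted⇒has T T∈ in
    S , S∈𝒮 , ~-trans S~T (subst (traceˢ T ~_) (trace-pair i j)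
      (HasParts⇒~ T (trace-─ (pair (pt i) (pt j))) parts))

  module _ (separating : Separating 𝒮) where

    separated : ∀ {P Q} → ∣ P ∣ ≡ 3 → ∣ Q ∣ ≡ 3 → P ≢ Q → ∃ λ p → Has p × Separates P Q p
    separated {P} {Q} ∣P∣≡3 ∣Q∣≡3 P≢Q =
      let S , S∈𝒮 , sep = separating (image pt P) (image pt Q)
            (size-image P ∣P∣≡3) (size-image Q ∣Q∣≡3)
            (λ eq → P≢Q (trans (sym (trace-image P)) (trans (cong trace eq) (trace-image Q))))
      in trace (left S) , (S , S∈𝒮 , ~-refl) ,
         λ eq → sep (trans (maj-image S P) (trans eq (sym (maj-image S Q))))
      where
      trace-image : ∀ P → trace (image pt P) ≡ P
      trace-image P = preimage-image pt P injective
      image⊆U : ∀ P → image pt P ⊆ U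
      image⊆U P x∈ with image-Covers pt P x∈
      ... | i , refl = at∈ i
      size-image : ∀ P → ∣ P ∣ ≡ 3 → ∣ image pt P ∣ ≡ 3
      size-image P eq = trans (sym (∣trace∣ (image⊆U P))) (trans (cong ∣_∣ (trace-image P)) eq)
      maj-image : ∀ S P → maj (left S) (image pt P) ≡ maj (trace (left S)) P
      maj-image S P = trans (trace-maj (left S) (image⊆U P))
        (cong (maj (trace (left S))) (trace-image P))

  separatesBy : ∀ {Y Y′ p} → Y ⊆ U → Y′ ⊆ U → ∣ Y ∣ ≡ 3 → ∣ Y′ ∣ ≡ 3 → Has p →
                Separates (trace Y) (trace Y′) p →
                ∃ λ S → Member 𝒮 S × maj (left S) Y ≢ maj (left S) Y′
  separatesBy {Y} {Y′} Y⊆U Y′⊆U h h′ (S , S∈𝒮 , S~p) sep = S , S∈𝒮 , λ eq →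
    separates-resp (trace Y) (trace Y′)
      (trans (∣trace∣ Y⊆U) h) (trans (∣trace∣ Y′⊆U) h′) (~-sym S~p) sep
      (trans (sym (trace-maj (left S) Y⊆U)) (trans eq (trace-maj (left S) Y′⊆U)))

enumerateAs : (U : Subset n) → ∣ U ∣ ≡ k → Enumeration U k
enumerateAs U eq = subst (Enumeration U) eq (enumerate U)

∈-triples⁺ : {P : Subset k} → ∣ P ∣ ≡ 3 → P ∈ˡ triples k
∈-triples⁺ {P = P} = ∈-filter⁺ (λ P → ∣ P ∣ ≟ⁿ 3) (∈-subsets P)

∈-triples⁻ : {P : Subset k} → P ∈ˡ triples k → ∣ P ∣ ≡ 3
∈-triples⁻ {k} = proj₂ ∘ ∈-filter⁻ (λ P → ∣ P ∣ ≟ⁿ 3) {xs = subsets k}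

-- Separation implies dicing

module Separating⇒Dices {𝒮 : SplitSystem n} (separating : Separating 𝒮) where

  module _ {U : Subset n} (en : Enumeration U (suc k)) where

    open Traces 𝒮 U en

    -- The split separating the images of `P` and `Q` leaves a trace of size at least 2, hence of
    -- size `r`; its pattern is listed in the clause of `P` and `Q`.
    clauses-met : ∀ r os → ¬ (3 ∈ˡ os) → (∀ {p} → Has p → 2 ≤ size± p → size± p ≡ r) →
                  All (Any (Has ∘ decode (patterns k r))) (clauses (patterns k r) os)
    clauses-met r os 3∉os only-r = All.concat⁺ (All.map⁺ (All.tabulate λ {P} P∈ →
      All.map⁺ (All.tabulate λ {Q} Q∈ →
        let Q∈ , o∈os = ∈-filter⁻ (overlap? os P) {xs = triples (suc k)} Q∈ in
        met (∈-triples⁻ P∈) (∈-triples⁻ Q∈) o∈os)))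
      where
      met : ∀ {P Q} → ∣ P ∣ ≡ 3 → ∣ Q ∣ ≡ 3 → ∣ P ∩ Q ∣ ∈ˡ os →
            Any (Has ∘ decode (patterns k r))
              (filter (separates? P Q ∘ decode (patterns k r)) (labels (patterns k r)))
      met {P} {Q} ∣P∣≡3 ∣Q∣≡3 o∈os =
        let p , (S , S∈𝒮 , S~p) , sep = separated separating ∣P∣≡3 ∣Q∣≡3
              -- Equal triples would meet in three points, a size excluded from `os`.
              (λ P≡Q → 3∉os (subst (_∈ˡ os) (∣P∩Q∣≡3 P≡Q) o∈os))
            q , q∈ , p~q = patterns-complete p
              (only-r (S , S∈𝒮 , S~p) (separates⇒2≤size± P Q ∣P∣≡3 ∣Q∣≡3 sep))
            m , m< , dm≡q = decode-surjective q∈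
            p~dm = subst (p ~_) (sym dm≡q) p~q
        in lose
          (∈-filter⁺ (separates? P Q ∘ decode (patterns k r)) (∈-upTo⁺ m<)
            (separates-resp P Q ∣P∣≡3 ∣Q∣≡3 p~dm sep))
          (S , S∈𝒮 , ~-trans S~p p~dm)
        where
        ∣P∩Q∣≡3 : P ≡ Q → ∣ P ∩ Q ∣ ≡ 3
        ∣P∩Q∣≡3 refl = trans (cong ∣_∣ (∩-idem P)) ∣P∣≡3

    family-dices : ∀ t os → T (familySearch t (patterns k 2) os) → ¬ (3 ∈ˡ os) →
                   Sizes (suc k) (2 ∷ []) → AtLeast t [ 2 ]-splitsIn (𝒮 ∣ʳ U)
    family-dices t os ok 3∉os sizes =
      let rs , has-rs , family = Search.search-sound
            (family? t 2 ∘ List.map (decode (patterns k 2)))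
            (has? ∘ decode (patterns k 2)) (clauses (patterns k 2) os) [] [] ok [] []
            (clauses-met 2 os 3∉os λ {p} _ 2≤ → only-2 (All.lookup sizes (∈-subsets p) 2≤))
      in family⇒atLeast (s≤s z≤n) family (All.map⁺ has-rs)
      where
      only-2 : ∀ {m} → m ∈ˡ 2 ∷ [] → m ≡ 2
      only-2 (here m≡2) = m≡2

    has-edge : ∀ {ps x y} → All Has ps → Any (_~ pair x y) ps → Has (pair x y)
    has-edge hps edge with All.lookupAny hps edge
    ... | (S , S∈𝒮 , S~p) , p~xy = S , S∈𝒮 , ~-trans S~p p~xy

    triangle⇒hasTriangle : PairSizes (suc k) → ∀ {ps} → All Has ps → Triangle ps →
                           HasTriangle (𝒮 ∣ʳ U)
    triangle⇒hasTriangle size≡2 hps (x , y , (x≢y , xy) , z , (x≢z , xz) , (y≢z , yz)) =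
      pt x , pt y , pt z , (at∈ x , at∈ y , at∈ z) ,
      (x≢y ∘ injective , x≢z ∘ injective , y≢z ∘ injective) ,
      has⇒pairSplit (size≡2 x y x≢y) (has-edge hps xy) ,
      has⇒pairSplit (size≡2 x z x≢z) (has-edge hps xz) ,
      has⇒pairSplit (size≡2 y z y≢z) (has-edge hps yz)
      where open Enumeration en renaming (at to pt)

    no-3-split⇒size±≡2 : ¬ Any Has (patterns k 3) →
                         ∀ {p} → Has p → size± p ∈ˡ 2 ∷ 3 ∷ [] → size± p ≡ 2
    no-3-split⇒size±≡2 none hp (here size≡2) = size≡2
    no-3-split⇒size±≡2 none {p} (S , S∈𝒮 , S~p) (there (here size≡3)) =
      let q , q∈ , p~q = patterns-complete p size≡3 in
      contradiction (lose q∈ (S , S∈𝒮 , ~-trans S~p p~q)) none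

    has-member : ∀ {ps rs} → All (Has ∘ decode ps) rs → ∀ m → T (any (m ≡ᵇ_) rs) → Has (decode ps m)
    has-member {ps} {rs} has-rs m m∈ with All.lookupAny has-rs (any⁻ (m ≡ᵇ_) rs m∈)
    ... | hr , m≡r = subst (Has ∘ decode ps) (sym (≡ᵇ⇒≡ m _ m≡r)) hr

    3-split-or-triangle : ∀ os → T (triangleSearch (patterns k 2) os) → ¬ (3 ∈ˡ os) →
      Sizes (suc k) (2 ∷ 3 ∷ []) → PairSizes (suc k) → AllTriangles (patterns k 2) →
      AtLeast 1 [ 3 ]-splitsIn (𝒮 ∣ʳ U) ⊎ HasTriangle (𝒮 ∣ʳ U)
    3-split-or-triangle os ok 3∉os sizes pair-sizes all-triangles with Any.any? has? (patterns k 3)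
    ... | yes some =
      let p , p∈ , hp = find some
          size≡3 = proj₂ (∈-filter⁻ (λ p → size± p ≟ⁿ 3) {xs = List.map (inside ∷_) (subsets k)} p∈)
      in inj₁ (family⇒atLeast (s≤s z≤n) (s≤s z≤n , [] ∷ [] , size≡3 ∷ []) (hp ∷ []))
    -- Without 3-splits all separating traces are 2-splits, so clauses over 2-splits alone are met.
    ... | no none =
      let rs , has-rs , met = Search.search-sound (meetsTriangle? (triangles (patterns k 2)))
            (has? ∘ decode (patterns k 2)) (clauses (patterns k 2) os) [] [] ok [] []
            (clauses-met 2 os 3∉os λ {p} hp 2≤ →
              no-3-split⇒size±≡2 none hp (All.lookup sizes (∈-subsets p) 2≤))
          ms , ms∈ , ms⊆rs = find (any⁻ (all (λ m → any (m ≡ᵇ_) rs)) (triangles (patterns k 2)) met)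
          has-ms = All.map (λ {m} → has-member {patterns k 2} has-rs m)
            (All.all⁺ (λ m → any (m ≡ᵇ_) rs) ms ms⊆rs)
      in inj₂ (triangle⇒hasTriangle pair-sizes (All.map⁺ has-ms) (All.lookup all-triangles ms∈))

  4-dices : 4-Dices 𝒮
  -- Distinct triples among four points meet in exactly two.
  4-dices = inj₂ λ U ∣U∣≡4 → family-dices (enumerateAs U ∣U∣≡4) 2 (2 ∷ []) familySearch₄
    (λ { (here ()) ; (there ()) }) sizes₄

  5-dices : 5-Dices 𝒮
  -- Distinct triples among five points meet in one or two.
  5-dices = inj₂ λ U ∣U∣≡5 → family-dices (enumerateAs U ∣U∣≡5) 5 (1 ∷ 2 ∷ []) familySearch₅
    (λ { (here ()) ; (there (here ())) ; (there (there ())) }) sizes₅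

  6-dices : 6-Dices 𝒮
  6-dices = inj₂ λ U ∣U∣≡6 → 3-split-or-triangle (enumerateAs U ∣U∣≡6)
    (0 ∷ 2 ∷ []) triangleSearch₆ (λ { (here ()) ; (there (here ())) ; (there (there ())) })
    sizes₆ pairSizes₆ allTriangles₆

-- Dicing implies separation

module Dices⇒Separating {𝒮 : SplitSystem n} {Y Y′ : Subset n}
                        (∣Y∣≡3 : ∣ Y ∣ ≡ 3) (∣Y′∣≡3 : ∣ Y′ ∣ ≡ 3) where

  U : Subset n
  U = Y ∪ Y′

  Separated : Set
  Separated = ∃ λ S → Member 𝒮 S × maj (left S) Y ≢ maj (left S) Y′

  module _ (en : Enumeration U k) where

    open Traces 𝒮 U en

    P Q : Subset k
    P = trace Y
    Q = trace Y′

    P∈ : P ∈ˡ triples k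
    P∈ = ∈-triples⁺ (trans (∣trace∣ (p⊆p∪q Y′)) ∣Y∣≡3)

    Q∈ : Q ∈ˡ triples k
    Q∈ = ∈-triples⁺ (trans (∣trace∣ (q⊆p∪q Y Y′)) ∣Y′∣≡3)

    P∪Q≡⊤ : P ∪ Q ≡ ⊤
    P∪Q≡⊤ = trans (sym (preimage-∪ (Enumeration.at en) Y Y′)) trace-U

    has⇒separated : ∀ {p} → Has p → Separates P Q p → Separated
    has⇒separated = separatesBy (p⊆p∪q Y′) (q⊆p∪q Y Y′) ∣Y∣≡3 ∣Y′∣≡3

  atLeast⇒separated : ∀ {r t} → FewFail k r t → Enumeration U (suc k) →
                      AtLeast t [ r ]-splitsIn (𝒮 ∣ʳ U) → Separated
  atLeast⇒separated {k} {r} {t} few en (T , T-good , T-distinct)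
    with anyᶠ? (λ i → separates? (P en) (Q en) (Traces.traceˢ 𝒮 U en (T i)))
  ... | yes (i , sep) = has⇒separated en (restricted⇒has (T i) (proj₁ (T-good i))) sep
    where open Traces 𝒮 U en
  ... | no none =
    -- If no `T i` separates, the `t` distinct splits are all represented by the fewer than `t`
    -- failing patterns.
    let i , j , i<j , same = pigeonhole
          (All.lookup (All.lookup few (P∈ en)) (Q∈ en) (P∪Q≡⊤ en)) (Any.index ∘ failing∈)
    in contradiction (T-distinct i j (~⇒HasParts (T i)
         (left⊆ (T j)) (right⊆ (T j)) (trace-right (T j))
         (~-trans (T~ i) (subst (_~ traceˢ (T j)) (sym (same-pattern i j same)) (~-sym (T~ j))))))
         (<⇒≢ i<j)
    where
    open Traces 𝒮 U en
    represent : ∀ i → ∃ λ q → q ∈ˡ patterns k r × traceˢ (T i) ~ q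
    represent i = patterns-complete (traceˢ (T i))
      (trans (sym (size-trace (T i))) (proj₂ (T-good i)))
    pattern-of : Fin t → Subset (suc k)
    pattern-of i = proj₁ (represent i)
    T~ : ∀ i → traceˢ (T i) ~ pattern-of i
    T~ i = proj₂ (proj₂ (represent i))
    failing : List (Subset (suc k))
    failing = filter (¬? ∘ separates? (P en) (Q en)) (patterns k r)
    failing∈ : ∀ i → pattern-of i ∈ˡ failing
    failing∈ i = ∈-filter⁺ (¬? ∘ separates? (P en) (Q en)) (proj₁ (proj₂ (represent i)))
      (λ sep → none (i , separates-resp (P en) (Q en)
        (∈-triples⁻ (P∈ en)) (∈-triples⁻ (Q∈ en)) (~-sym (T~ i)) sep))
    same-pattern : ∀ i j → Any.index (failing∈ i) ≡ Any.index (failing∈ j) →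
                   pattern-of i ≡ pattern-of j
    same-pattern i j same = trans (lookup-index (failing∈ i))
      (trans (cong (List.lookup failing) same) (sym (lookup-index (failing∈ j))))

  triangle⇒separated : TrianglesSeparate k → Enumeration U k → HasTriangle (𝒮 ∣ʳ U) → Separated
  triangle⇒separated tri en (x , y , z , (x∈ , y∈ , z∈) , (x≢y , x≢z , y≢z) , xy , xz , yz)
    with Enumeration.onto en x∈ | Enumeration.onto en y∈ | Enumeration.onto en z∈
  ... | i , refl | j , refl | l , refl
    with All.lookup (All.lookup tri (P∈ en)) (Q∈ en) (P∪Q≡⊤ en) i j l
      (x≢y ∘ cong pt) (x≢z ∘ cong pt) (y≢z ∘ cong pt)
    where open Enumeration en renaming (at to pt)
  ...   | inj₁ sep        = has⇒separated en (Traces.pairSplit⇒has 𝒮 U en xy) sep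
  ...   | inj₂ (inj₁ sep) = has⇒separated en (Traces.pairSplit⇒has 𝒮 U en xz) sep
  ...   | inj₂ (inj₂ sep) = has⇒separated en (Traces.pairSplit⇒has 𝒮 U en yz) sep

  ∣U∣+∣∩∣≡6 : ∣ U ∣ + ∣ Y ∩ Y′ ∣ ≡ 6
  ∣U∣+∣∩∣≡6 = trans (∣p∪q∣+∣p∩q∣≡∣p∣+∣q∣ Y Y′) (cong₂ _+_ ∣Y∣≡3 ∣Y′∣≡3)

  too-small : ∀ {m} → ∣ U ∣ ≡ m → ¬ (n < m)
  too-small refl n<∣U∣ = <⇒≱ n<∣U∣ (∣p∣≤n U)

  dices⇒separated : 4-Dices 𝒮 → 5-Dices 𝒮 → 6-Dices 𝒮 → Y ≢ Y′ → Separated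
  dices⇒separated d₄ d₅ d₆ Y≢Y′ = go ∣ Y ∩ Y′ ∣ refl
    where
    ∣∩∣≤3 : ∣ Y ∩ Y′ ∣ ≤ 3
    ∣∩∣≤3 = ≤-trans (∣p∩q∣≤∣p∣ Y Y′) (≤-reflexive ∣Y∣≡3)
    ∣U∣ : ∀ {i} m → ∣ Y ∩ Y′ ∣ ≡ i → m + i ≡ 6 → ∣ U ∣ ≡ m
    ∣U∣ {i} m refl eq = +-cancelʳ-≡ i ∣ U ∣ m (trans ∣U∣+∣∩∣≡6 (sym eq))
    go : ∀ i → ∣ Y ∩ Y′ ∣ ≡ i → Separated
    go 0 eq = [ (λ n<6 → contradiction n<6 (too-small (∣U∣ 6 eq refl)))
              , (λ dices →
                  [ atLeast⇒separated fewFail₆ en , triangle⇒separated trianglesSeparate₆ en ]′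
                  (dices U (∣U∣ 6 eq refl))) ]′ d₆
      where en = enumerateAs U (∣U∣ 6 eq refl)
    go 1 eq = [ (λ n<5 → contradiction n<5 (too-small (∣U∣ 5 eq refl)))
              , (λ dices → atLeast⇒separated fewFail₅ (enumerateAs U (∣U∣ 5 eq refl))
                  (dices U (∣U∣ 5 eq refl))) ]′ d₅
    go 2 eq = [ (λ n<4 → contradiction n<4 (too-small (∣U∣ 4 eq refl)))
              , (λ dices → atLeast⇒separated fewFail₄ (enumerateAs U (∣U∣ 4 eq refl))
                  (dices U (∣U∣ 4 eq refl))) ]′ d₄
    go 3 eq = contradiction (trans (sym (∩≡ (p∩q⊆p Y Y′) ∣Y∣≡3)) (∩≡ (p∩q⊆q Y Y′) ∣Y′∣≡3)) Y≢Y′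
      where
      ∩≡ : ∀ {Z} → Y ∩ Y′ ⊆ Z → ∣ Z ∣ ≡ 3 → Y ∩ Y′ ≡ Z
      ∩≡ ⊆Z ∣Z∣≡3 = p⊆q∧∣q∣≤∣p∣⇒p≡q ⊆Z (≤-reflexive (trans ∣Z∣≡3 (sym eq)))
    go (suc (suc (suc (suc i)))) eq =
      contradiction (≤-trans (≤-reflexive (sym eq)) ∣∩∣≤3) λ { (s≤s (s≤s (s≤s ()))) }

theorem2 : (n : ℕ) → 3 ≤ n → (𝒮 : SplitSystem n) →
    Injective 𝒮 ⇔ (4-Dices 𝒮 × 5-Dices 𝒮 × 6-Dices 𝒮)
theorem2 n _ 𝒮 = mk⇔ to from
  where
  open Medians 𝒮
  to : Injective 𝒮 → 4-Dices 𝒮 × 5-Dices 𝒮 × 6-Dices 𝒮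
  to inj = 4-dices , 5-dices , 6-dices
    where open Separating⇒Dices {𝒮 = 𝒮} (injective⇒separating inj)
  from : 4-Dices 𝒮 × 5-Dices 𝒮 × 6-Dices 𝒮 → Injective 𝒮
  from (d₄ , d₅ , d₆) = separating⇒injective λ Y Y′ ∣Y∣≡3 ∣Y′∣≡3 →
    Dices⇒Separating.dices⇒separated {𝒮 = 𝒮} ∣Y∣≡3 ∣Y′∣≡3 d₄ d₅ d₆
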